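{- There is a constant $k$ and a family $\{F_n\}_{n=1}^{\infty}$ of unsatisfiable $k$-CNF formulas of size $\Theta(n)$ such that: (1) the minimal width of refuting $F_n$ in resolution is $W(F_n\vdash 0)=\Theta(\sqrt[3]{n})$; (2) any resolution refutation $\pi$ of $F_n$ in minimal width (i.e. with $W(\pi)=W(F_n\vdash 0)$) must have length $L(\pi)=\exp\bigl(\Omega(\sqrt[3]{n})\bigr)$; (3) there are resolution refutations $\pi'$ of $F_n$ with (simultaneously) $W(\pi')=O\bigl(W(F_n\vdash 0)\bigr)$ and $L(\pi')=O(n)$.
   Context: A literal is a propositional variable $x$ or its negation $\overline{x}$. A clause is a finite set (disjunction) of literals over pairwise distinct variables; $0$ denotes the empty clause. A CNF formula is a finite set of clauses; it is a $k$-CNF formula if every clause has at most $k$ literals. The size of a CNF formula is the total number of literals in it, counted with repetitions. A resolution refutation of a CNF formula $F$ is a sequence of clauses ending with $0$ in which every clause either belongs to $F$ or is obtained from two earlier clauses by the resolution rule, which derives $B\vee C$ from $B\vee x$ and $C\vee\overline{x}$. The length $L(\pi)$ of a refutation $\pi$ is the number of clauses in it, its width $W(\pi)$ is the maximal number of literals in any clause in it, and $W(F\vdash 0)$ is the minimum width over all refutations of $F$. -}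

module Defs where

open import Data.Bool.Base using (Bool; true; not)
open import Data.List.Base using (List; []; _∷_; _++_; foldr; length; map; sum)
open import Data.List.Membership.Propositional using (_∈_)
open import Data.List.Relation.Binary.BagAndSetEquality using (_∼[_]_; set)
open import Data.List.Relation.Binary.Permutation.Propositional using (_↭_)
open import Data.List.Relation.Unary.All using (All)
open import Data.List.Relation.Unary.AllPairs using (AllPairs; [])
open import Data.List.Relation.Unary.Any using (Any)
open import Data.List.Relation.Unary.Unique.Propositional using (Unique)
open import Data.Nat.Base using (ℕ; zero; suc; _*_; _^_; _≤_; _<_; _⊔_; z≤n; s≤s)
open import Data.Nat.Properties using (_≤?_; ≰⇒>; ≤-trans; n≤1+n; ^-monoˡ-<; n<1+n)
open import Data.Product.Base using (_×_; _,_; ∃-syntax; proj₁; proj₂)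
open import Relation.Binary.PropositionalEquality.Core using (_≡_)
open import Relation.Nullary using (¬_; yes; no)

Variable : Set
Variable = ℕ

data Literal : Set where
  pos neg : Variable → Literal

var : Literal → Variable
var (pos x) = x
var (neg x) = x

-- A finite set is a list without repetitions, considered up to _≈_. Distinctness
-- of the variables makes the literals distinct, so length is cardinality.
record Clause : Set where
  constructor mkClause
  field
    literals : List Literal
    distinct : Unique (map var literals)

open Clause public

_≈_ : Clause → Clause → Set
C ≈ D = literals C ∼[ set ] literals D

𝟘 : Clause
𝟘 = mkClause [] []

width : Clause → ℕ
width C = length (literals C)

record CNF : Set where
  constructor mkCNF
  field
    clauses  : List Clause
    distinct : AllPairs (λ C D → ¬ (C ≈ D)) clauses

open CNF public using (clauses)

_is_-CNF : CNF → ℕ → Set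
F is k -CNF = All (λ C → width C ≤ k) (clauses F)

size : CNF → ℕ
size F = sum (map width (clauses F))

Assignment : Set
Assignment = Variable → Bool

value : Assignment → Literal → Bool
value α (pos x) = α x
value α (neg x) = not (α x)

_⊨_ : Assignment → CNF → Set
α ⊨ F = All (λ C → Any (λ l → value α l ≡ true) (literals C)) (clauses F)

Unsatisfiable : CNF → Set
Unsatisfiable F = ∀ α → ¬ (α ⊨ F)

-- D is B ∨ x, E is C ∨ x̄ and R is B ∨ C. The premises are matched with _↭_, so x
-- does not occur in B nor x̄ in C; R is matched as a set, which merges the literals
-- common to B and C. As R is a Clause, B ∨ C contains no complementary literals.
Resolves : Clause → Clause → Clause → Set
Resolves D E R = ∃[ x ] ∃[ B ] ∃[ C ]
  (literals D ↭ pos x ∷ B) × (literals E ↭ neg x ∷ C) × (literals R ∼[ set ] (B ++ C))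

data Justified (F : CNF) (π : List Clause) (C : Clause) : Set where
  axiom   : Any (C ≈_) (clauses F) → Justified F π C
  resolve : ∀ {D E} → D ∈ π → E ∈ π → Resolves D E C → Justified F π C

-- The sequence of clauses is listed in reverse: its last clause is the head.
data Derivation (F : CNF) : List Clause → Set where
  []  : Derivation F []
  _∷_ : ∀ {C π} → Justified F π C → Derivation F π → Derivation F (C ∷ π)

Refutes : List Clause → CNF → Set
Refutes π F = Derivation F π × ∃[ C ] ∃[ π′ ] (π ≡ C ∷ π′ × C ≈ 𝟘)

L : List Clause → ℕ
L = length

W : List Clause → ℕ
W π = foldr _⊔_ 0 (map width π)

-- W(F ⊢ 0) = w
W[_⊢𝟘]≡_ : CNF → ℕ → Set
W[ F ⊢𝟘]≡ w = (∃[ π ] (Refutes π F × W π ≡ w)) × (∀ π → Refutes π F → w ≤ W π)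

-- The implicit constant of a lower bound f ≥ δ g is given as δ = 1 / c.
_∈O_ _∈Ω_ _∈Θ_ : (ℕ → ℕ) → (ℕ → ℕ) → Set
f ∈O g = ∃[ c ] ∃[ N ] (∀ n → N ≤ n → f n ≤ c * g n)
f ∈Ω g = ∃[ c ] ∃[ N ] (∀ n → N ≤ n → g n ≤ c * f n)
f ∈Θ g = (f ∈O g) × (f ∈Ω g)

-- The integer part of the cube root. Since ⌊∛ n ⌋ ≤ ∛n ≤ 2 ⌊∛ n ⌋ for n ≥ 1, it
-- has the same order of growth as ∛n.
⌊∛_⌋ : ℕ → ℕ
⌊∛ zero ⌋ = 0
⌊∛ suc n ⌋ with suc ⌊∛ n ⌋ ^ 3 ≤? suc n
... | yes _ = suc ⌊∛ n ⌋
... | no  _ = ⌊∛ n ⌋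

⌊∛⌋-spec : ∀ n → (⌊∛ n ⌋ ^ 3 ≤ n) × (n < suc ⌊∛ n ⌋ ^ 3)
⌊∛⌋-spec zero = z≤n , s≤s z≤n
⌊∛⌋-spec (suc n) with suc ⌊∛ n ⌋ ^ 3 ≤? suc n
... | yes p = p , ≤-trans (s≤s (proj₂ (⌊∛⌋-spec n))) (^-monoˡ-< 3 (n<1+n (suc ⌊∛ n ⌋)))
... | no ¬p = ≤-trans (proj₁ (⌊∛⌋-spec n)) (n≤1+n n) , ≰⇒> ¬p

{-# OPTIONS --safe #-}

-- F_n is the conjunction of two formulas without common variables, and of n unit clauses
-- that only serve to give it size Θ(n). The easy formula is the ordering principle for m
-- elements, of size Θ(m³), width Ω(m) and refutations of length O(m³) and width O(m). The
-- hard formula is the ordering principle for t elements with every variable replaced by an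
-- exclusive or of two; its refutations of any width have length exp(Ω(t)), but some have
-- width less than what the easy formula needs, if m is a large enough multiple of t. With t
-- and m of order ∛n, refutations of minimal width are then confined to the hard formula.
--
-- Lower bounds: an assignment given by a linear order falsifies only axioms on its bottom
-- element, which can be changed unnoticed to any element that the current clause does not
-- mention. So a refutation contains a clause, falsified by such an assignment, that mentions
-- almost all elements. For the hard formula one first fixes a random half of each exclusive
-- or to a random value: a clause on b exclusive ors stays unsatisfied with probability
-- at most (3/4)^b.
module Submission where

open import Data.Bool.Base using (Bool; true; false; not; _xor_; _∧_)
open import Data.Bool.Properties
  using (not-injective; not-¬; xor-same; xor-assoc; xor-identityʳ) renaming (_≟_ to _≟ᵇ_)
open import Data.Empty using (⊥-elim)
open import Data.List.Base
  using (List; []; _∷_; _++_; [_]; length; map; filter; concatMap; upTo; foldr; deduplicate)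
open import Data.List.Membership.Propositional using (_∈_; _∉_; find; lose)
open import Data.List.Membership.Propositional.Properties
  using (∈-++⁺ˡ; ∈-++⁺ʳ; ∈-++⁻; ∈-∃++; ∈-filter⁺; ∈-filter⁻; ∈-map⁺; ∈-map⁻; ∈-upTo⁺; ∈-upTo⁻;
         ∈-concat⁺′; ∈-concatMap⁺; ∈-concatMap⁻; ∈-deduplicate⁺; ∈-deduplicate⁻)
open import Data.List.Membership.Propositional.Properties.WithK using (unique∧set⇒bag)
open import Data.List.Properties using (length-++; length-upTo; length-map; length-filter; length-deduplicate)
open import Data.List.Relation.Binary.BagAndSetEquality using (_∼[_]_; set; ∼bag⇒↭)
open import Data.List.Relation.Binary.Permutation.Propositional using (_↭_; ↭-sym; ↭⇒↭ₛ)
open import Data.List.Relation.Binary.Permutation.Propositional.Properties using (∈-resp-↭; ↭-length)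
import Data.List.Relation.Binary.Permutation.Setoid.Properties as Permutationₛ
open import Data.List.Relation.Binary.Subset.Propositional using (_⊆_)
open import Data.List.Relation.Unary.All as All using (All; []; _∷_)
open import Data.List.Relation.Unary.All.Properties using (¬All⇒Any¬; ¬Any⇒All¬)
open import Data.List.Relation.Unary.AllPairs using ([]; _∷_)
open import Data.List.Relation.Unary.Any as Any using (Any; here; there; any?)
open import Data.List.Relation.Unary.Unique.Propositional using (Unique)
import Data.List.Relation.Unary.Unique.Propositional.Properties as Unique
open import Data.Nat.Base
open import Data.Nat.Properties
open import Data.Nat.Tactic.RingSolver using (solve-∀)
open import Data.Product.Base using (_×_; _,_; Σ-syntax; ∃-syntax; proj₁; proj₂)
open import Data.Sum.Base as Sum using (_⊎_; inj₁; inj₂; [_,_]′)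
open import Function.Base using (_∘_; id; case_of_)
open import Function.Bundles using (Equivalence; mk⇔)
open import Relation.Binary.Definitions using (DecidableEquality)
open import Relation.Binary.PropositionalEquality
  using (_≡_; _≢_; refl; sym; trans; cong; cong₂; subst; setoid; module ≡-Reasoning)
open import Relation.Nullary using (¬_; Dec; does; yes; no; ¬?; contradiction)
open import Relation.Nullary.Decidable using (map′; _×-dec_; _⊎-dec_)

import Data.List.Membership.DecPropositional as DecMembership
open import Data.List.Relation.Unary.Unique.DecPropositional.Properties using (deduplicate-!)
import Data.List.Relation.Unary.Unique.DecPropositional as DecUnique

open import Defs

-- The minimal width must be exhibited as a number, so the existence of a refutation of given width
-- is shown to be decidable: resolution creates no new literals, hence up to `≈` there are finitely
-- many clauses to saturate.
--
-- The clause "some element precedes j" has m literals, while axioms must have bounded width. The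
-- variables `below j i` spell it out as a chain along the possible witnesses of j.
--
-- The plain ordering principle has short refutations, so its width alone does not force length. The
-- substitution makes every exclusive or that a clause touches an independent chance for the clause
-- to be satisfied by the restriction.
--
-- Both lower bounds rest on one statement: in a refutation it cannot happen that every clause
-- falsified by an assignment of the given kind mentions few elements in the easy and in the hard
-- part. For the width, narrow clauses mention few elements of either part. For the length, width
-- limits the easy elements and the restriction limits the hard ones.

unique-length : ∀ {A : Set} {xs ys : List A} → Unique xs → xs ⊆ ys → length xs ≤ length ys
unique-length [] _ = z≤n
unique-length {xs = x ∷ xs} (x∉ ∷ u) xs⊆ys with ∈-∃++ (xs⊆ys (here refl))
... | as , bs , refl = begin
  suc (length xs)                ≤⟨ s≤s (unique-length u xs⊆) ⟩
  suc (length (as ++ bs))        ≡⟨ cong suc (length-++ as) ⟩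
  suc (length as + length bs)    ≡⟨ +-suc (length as) (length bs) ⟨
  length as + length (x ∷ bs)    ≡⟨ length-++ as ⟨
  length (as ++ [ x ] ++ bs)     ∎
  where
  open ≤-Reasoning
  xs⊆ : xs ⊆ as ++ bs
  xs⊆ {z} z∈ with ∈-++⁻ as (xs⊆ys (there z∈))
  ... | inj₁ z∈as = ∈-++⁺ˡ z∈as
  ... | inj₂ (here refl) = contradiction refl (All.lookup x∉ z∈)
  ... | inj₂ (there z∈bs) = ∈-++⁺ʳ as z∈bs

fresh : ∀ {m} ys → length ys < m → ∃[ f ] (f < m × f ∉ ys)
fresh {m} ys ys<m with All.all? (_∈? ys) (upTo m)
  where open DecMembership _≟_ using (_∈?_)
... | yes all∈ = contradiction ys<m (≤⇒≯ (subst (_≤ length ys) (length-upTo m)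
                   (unique-length (Unique.upTo⁺ m) (All.lookup all∈))))
... | no ¬all∈ with find (¬All⇒Any¬ (_∈? ys) (upTo m) ¬all∈)
  where open DecMembership _≟_ using (_∈?_)
...   | f , f∈ , f∉ys = f , ∈-upTo⁻ f∈ , f∉ys

least : ∀ {P : ℕ → Set} → (∀ n → Dec (P n)) → ∀ {n} → P n → ∃[ m ] (P m × (∀ k → P k → m ≤ k))
least P? {n} Pn with P? 0
... | yes P0 = 0 , P0 , λ _ _ → z≤n
least P? {zero} P0 | no ¬P0 = contradiction P0 ¬P0
least P? {suc n} Pn | no ¬P0 with least (P? ∘ suc) Pn
... | m , Pm , min = suc m , Pm , λ where
  zero P0 → contradiction P0 ¬P0
  (suc k) Pk → s≤s (min k Pk)

-- Literals and clauses

infix 4 _≟ˡ_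
_≟ˡ_ : DecidableEquality Literal
pos x ≟ˡ pos y = map′ (cong pos) (cong var) (x ≟ y)
pos _ ≟ˡ neg _ = no λ ()
neg _ ≟ˡ pos _ = no λ ()
neg x ≟ˡ neg y = map′ (cong neg) (cong var) (x ≟ y)

open DecMembership _≟ˡ_ using (_∈?_)

infix 4 _∼?_
_∼?_ : (ls ms : List Literal) → Dec (ls ∼[ set ] ms)
ls ∼? ms = map′ (λ (s , t) → mk⇔ (All.lookup s) (All.lookup t))
                (λ e → All.tabulate (Equivalence.to e) , All.tabulate (Equivalence.from e))
                (All.all? (_∈? ms) ls ×-dec All.all? (_∈? ls) ms)

∼-refl : ∀ {ls : List Literal} → ls ∼[ set ] ls
∼-refl = mk⇔ id id

∼-sym : ∀ {ls ms : List Literal} → ls ∼[ set ] ms → ms ∼[ set ] ls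
∼-sym e = mk⇔ (Equivalence.from e) (Equivalence.to e)

∼-trans : ∀ {ls ms ns : List Literal} → ls ∼[ set ] ms → ms ∼[ set ] ns → ls ∼[ set ] ns
∼-trans e f = mk⇔ (Equivalence.to f ∘ Equivalence.to e) (Equivalence.from e ∘ Equivalence.from f)

∼-unique⇒↭ : ∀ {ls ms : List Literal} → Unique ls → Unique ms → ls ∼[ set ] ms → ls ↭ ms
∼-unique⇒↭ u v e = ∼bag⇒↭ (unique∧set⇒bag u v e)

literals-unique : ∀ C → Unique (literals C)
literals-unique C = Unique.map⁻ (Clause.distinct C)

≈-width : ∀ {C D} → C ≈ D → width C ≡ width D
≈-width {C} {D} e = ↭-length (∼-unique⇒↭ (literals-unique C) (literals-unique D) e)

unique-map-injective : ∀ {A B : Set} {f : A → B} {xs} → Unique (map f xs) →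
  ∀ {x y} → x ∈ xs → y ∈ xs → f x ≡ f y → x ≡ y
unique-map-injective (_ ∷ u) (here refl) (here refl) _ = refl
unique-map-injective {f = f} (fx∉ ∷ u) (here refl) (there y∈) e =
  contradiction e (All.lookup fx∉ (∈-map⁺ f y∈))
unique-map-injective {f = f} (fy∉ ∷ u) (there x∈) (here refl) e =
  contradiction (sym e) (All.lookup fy∉ (∈-map⁺ f x∈))
unique-map-injective (_ ∷ u) (there x∈) (there y∈) e = unique-map-injective u x∈ y∈ e

injective-unique-map : ∀ {A B : Set} {f : A → B} {xs} → Unique xs →
  (∀ {x y} → x ∈ xs → y ∈ xs → f x ≡ f y → x ≡ y) → Unique (map f xs)
injective-unique-map [] _ = []
injective-unique-map {f = f} {x ∷ xs} (x∉ ∷ u) inj =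
  All.tabulate (λ y∈ e → case ∈-map⁻ f y∈ of λ where
    (z , z∈ , refl) → All.lookup x∉ z∈ (inj (here refl) (there z∈) e))
  ∷ injective-unique-map u λ x∈ y∈ → inj (there x∈) (there y∈)

-- Resolution

remove : Literal → List Literal → List Literal
remove l = filter (λ m → ¬? (m ≟ˡ l))

∈-remove⁺ : ∀ {l m ls} → m ∈ ls → m ≢ l → m ∈ remove l ls
∈-remove⁺ {l} = ∈-filter⁺ (λ m → ¬? (m ≟ˡ l))

∈-remove⁻ : ∀ {l m} ls → m ∈ remove l ls → m ∈ ls × m ≢ l
∈-remove⁻ {l} ls = ∈-filter⁻ (λ m → ¬? (m ≟ˡ l)) {xs = ls}

-- `Resolves` quantifies over the remainders B and C. Here `remove` computes them, so that the rule
-- becomes decidable and depends on the premises only as sets.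
record Resolvent (x : Variable) (D E R : List Literal) : Set where
  constructor mkResolvent
  field
    pos∈   : pos x ∈ D
    neg∈   : neg x ∈ E
    union  : R ∼[ set ] (remove (pos x) D ++ remove (neg x) E)

  left : ∀ {l} → l ∈ D → l ≡ pos x ⊎ l ∈ R
  left {l} l∈D with l ≟ˡ pos x
  ... | yes e = inj₁ e
  ... | no ¬e = inj₂ (Equivalence.from union (∈-++⁺ˡ (∈-remove⁺ l∈D ¬e)))

  right : ∀ {l} → l ∈ E → l ≡ neg x ⊎ l ∈ R
  right {l} l∈E with l ≟ˡ neg x
  ... | yes e = inj₁ e
  ... | no ¬e = inj₂ (Equivalence.from union (∈-++⁺ʳ (remove (pos x) D) (∈-remove⁺ l∈E ¬e)))

  source : ∀ {l} → l ∈ R → (l ∈ D × l ≢ pos x) ⊎ (l ∈ E × l ≢ neg x)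
  source l∈R = Sum.map (∈-remove⁻ D) (∈-remove⁻ E)
    (∈-++⁻ (remove (pos x) D) (Equivalence.to union l∈R))

mkResolvent′ : ∀ {x D E R} → pos x ∈ D → neg x ∈ E →
  (∀ {l} → l ∈ D → l ≡ pos x ⊎ l ∈ R) → (∀ {l} → l ∈ E → l ≡ neg x ⊎ l ∈ R) →
  (∀ {l} → l ∈ R → (l ∈ D × l ≢ pos x) ⊎ (l ∈ E × l ≢ neg x)) → Resolvent x D E R
mkResolvent′ {x} {D} {E} p n left right source = mkResolvent p n (mk⇔
  (λ l∈R → [ (λ (l∈ , ≢x) → ∈-++⁺ˡ (∈-remove⁺ l∈ ≢x))
           , (λ (l∈ , ≢x) → ∈-++⁺ʳ (remove (pos x) D) (∈-remove⁺ l∈ ≢x)) ]′ (source l∈R))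
  (λ l∈ → [ (λ l∈D → let l∈ , ≢x = ∈-remove⁻ D l∈D in [ (λ e → contradiction e ≢x) , id ]′ (left l∈))
          , (λ l∈E → let l∈ , ≢x = ∈-remove⁻ E l∈E in [ (λ e → contradiction e ≢x) , id ]′ (right l∈)) ]′
          (∈-++⁻ (remove (pos x) D) l∈)))

remove-↭ : ∀ {l D B} → Unique D → D ↭ l ∷ B → remove l D ∼[ set ] B
remove-↭ {l} {D} {B} u p = mk⇔ to from
  where
  uB : Unique (l ∷ B)
  uB = Permutationₛ.Unique-resp-↭ (setoid Literal) (↭⇒↭ₛ p) u
  to : ∀ {z} → z ∈ remove l D → z ∈ B
  to z∈ with ∈-remove⁻ D z∈
  ... | z∈D , z≢l with ∈-resp-↭ p z∈D
  ...   | here e = contradiction e z≢l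
  ...   | there z∈B = z∈B
  from : ∀ {z} → z ∈ B → z ∈ remove l D
  from z∈B = ∈-remove⁺ (∈-resp-↭ (↭-sym p) (there z∈B))
    λ where refl → Unique.Unique[x∷xs]⇒x∉xs uB z∈B

↭-remove : ∀ {l D} → Unique D → l ∈ D → D ↭ l ∷ remove l D
↭-remove {l} {D} u l∈D = ∼-unique⇒↭ u
  (All.tabulate (λ z∈ e → proj₂ (∈-remove⁻ D z∈) (sym e)) ∷ Unique.filter⁺ _ u)
  (mk⇔ to λ where (here refl) → l∈D ; (there z∈) → proj₁ (∈-remove⁻ D z∈))
  where
  to : ∀ {z} → z ∈ D → z ∈ l ∷ remove l D
  to {z} z∈D with z ≟ˡ l
  ... | yes e = here e
  ... | no ¬e = there (∈-remove⁺ z∈D ¬e)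

++-cong-∼ : ∀ {as bs cs ds : List Literal} → as ∼[ set ] bs → cs ∼[ set ] ds → (as ++ cs) ∼[ set ] (bs ++ ds)
++-cong-∼ e f = ++-cong e f
  where open import Data.List.Relation.Binary.BagAndSetEquality using (++-cong)

Resolves⇒Resolvent : ∀ {D E R} → Resolves D E R → ∃[ x ] Resolvent x (literals D) (literals E) (literals R)
Resolves⇒Resolvent {D} {E} (x , B , C , p , q , e) = x , mkResolvent
  (∈-resp-↭ (↭-sym p) (here refl)) (∈-resp-↭ (↭-sym q) (here refl))
  (∼-trans e (++-cong-∼ (∼-sym (remove-↭ (literals-unique D) p)) (∼-sym (remove-↭ (literals-unique E) q))))

Resolvent⇒Resolves : ∀ {D E R x} → Resolvent x (literals D) (literals E) (literals R) → Resolves D E R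
Resolvent⇒Resolves {D} {E} {R} {x} r = x , _ , _ ,
  ↭-remove (literals-unique D) pos∈ , ↭-remove (literals-unique E) neg∈ , union
  where open Resolvent r

Resolvent-cong : ∀ {x D D′ E E′ R R′} → D ∼[ set ] D′ → E ∼[ set ] E′ → R ∼[ set ] R′ →
  Resolvent x D E R → Resolvent x D′ E′ R′
Resolvent-cong d e f r = mkResolvent′ (Equivalence.to d pos∈) (Equivalence.to e neg∈)
  (Sum.map₂ (Equivalence.to f) ∘ left ∘ Equivalence.from d)
  (Sum.map₂ (Equivalence.to f) ∘ right ∘ Equivalence.from e)
  (Sum.map (λ (p , q) → Equivalence.to d p , q) (λ (p , q) → Equivalence.to e p , q) ∘ source ∘ Equivalence.from f)
  where open Resolvent r

resolvent? : ∀ x D E R → Dec (Resolvent x D E R)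
resolvent? x D E R = map′ (λ (p , n , e) → mkResolvent p n (λ {z} → e {z})) (λ r → let open Resolvent r in pos∈ , neg∈ , λ {z} → union {z})
  ((pos x ∈? D) ×-dec (neg x ∈? E) ×-dec (R ∼? (remove (pos x) D ++ remove (neg x) E)))

-- A pivot occurs in the first premise, so only its variables have to be tried.
resolves? : ∀ D E R → Dec (Resolves D E R)
resolves? D E R = map′
  (λ any → Resolvent⇒Resolves {D} {E} {R} (proj₂ (Any.satisfied any)))
  (λ res → let x , r = Resolves⇒Resolvent {D} {E} {R} res in lose (∈-map⁺ var (Resolvent.pos∈ r)) r)
  (any? (λ x → resolvent? x (literals D) (literals E) (literals R)) (map var (literals D)))

justified? : ∀ F π C → Dec (Justified F π C)
justified? F π C = map′ to from
  (any? (λ A → literals C ∼? literals A) (clauses F) ⊎-dec any? (λ D → any? (λ E → resolves? D E C) π) π)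
  where
  to : Any (C ≈_) (clauses F) ⊎ Any (λ D → Any (λ E → Resolves D E C) π) π → Justified F π C
  to (inj₁ a) = axiom a
  to (inj₂ r) with find r
  ... | D , D∈ , r′ with find r′
  ...   | E , E∈ , res = resolve D∈ E∈ res
  from : Justified F π C → Any (C ≈_) (clauses F) ⊎ Any (λ D → Any (λ E → Resolves D E C) π) π
  from (axiom a) = inj₁ a
  from (resolve D∈ E∈ res) = inj₂ (lose D∈ (lose E∈ res))

-- Saturation works with representatives up to `≈`, to which the lines of an arbitrary derivation
-- have to be transferred.
justified-cong : ∀ {F π π′ C C′} → (∀ {D} → D ∈ π → ∃[ D′ ] (D′ ∈ π′ × D ≈ D′)) → C ≈ C′ →
  Justified F π C → Justified F π′ C′
justified-cong _ e (axiom a) = axiom (Any.map (∼-trans (∼-sym e)) a)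
justified-cong {C = C} {C′} sub e (resolve {D} {E} D∈ E∈ res) with sub D∈ | sub E∈ | Resolves⇒Resolvent {D} {E} {C} res
... | D′ , D′∈ , d | E′ , E′∈ , f | x , r =
  resolve D′∈ E′∈ (Resolvent⇒Resolves {D′} {E′} {C′} (Resolvent-cong d f e r))

Narrow : ℕ → List Clause → Set
Narrow w = All (λ C → width C ≤ w)

W≤⇒Narrow : ∀ {w} π → W π ≤ w → Narrow w π
W≤⇒Narrow [] _ = []
W≤⇒Narrow (C ∷ π) h = m⊔n≤o⇒m≤o (width C) (W π) h ∷ W≤⇒Narrow π (m⊔n≤o⇒n≤o (width C) (W π) h)

Narrow⇒W≤ : ∀ {w π} → Narrow w π → W π ≤ w
Narrow⇒W≤ [] = z≤n
Narrow⇒W≤ (h ∷ hs) = ⊔-lub h (Narrow⇒W≤ hs)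

Derivation-preserves : ∀ {F} (P : Clause → Set) →
  (∀ {C A} → A ∈ clauses F → C ≈ A → P C) → (∀ {D E R} → Resolves D E R → P D → P E → P R) →
  ∀ {π} → Derivation F π → All P π
Derivation-preserves P ax step [] = []
Derivation-preserves P ax step (axiom a ∷ d) with find a
... | A , A∈ , e = ax A∈ e ∷ Derivation-preserves P ax step d
Derivation-preserves P ax step (resolve {D} {E} D∈ E∈ res ∷ d) with Derivation-preserves P ax step d
... | ih = step {D} {E} res (All.lookup ih D∈) (All.lookup ih E∈) ∷ ih

-- Formulas given by lists of lists of literals

private
  unique? : (ls : List Literal) → Dec (Unique (map var ls))
  unique? ls = DecUnique.unique? _≟_ (map var ls)

-- Lists of literals that are not clauses, and repeated clauses, are dropped.
insert : List Literal → CNF → CNF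
insert p (mkCNF Cs d) with unique? p
... | no _ = mkCNF Cs d
... | yes u with any? (λ C → p ∼? literals C) Cs
...   | yes _ = mkCNF Cs d
...   | no ¬old = mkCNF (mkClause p u ∷ Cs) (All.map (λ ≉ e → ≉ (λ {z} → e {z})) (¬Any⇒All¬ Cs ¬old) ∷ d)

toCNF : List (List Literal) → CNF
toCNF = foldr insert (mkCNF [] [])

∈-insert⁻ : ∀ {C} p F → C ∈ clauses (insert p F) → literals C ≡ p ⊎ C ∈ clauses F
∈-insert⁻ p (mkCNF Cs d) C∈ with unique? p
... | no _ = inj₂ C∈
... | yes u with any? (λ C → p ∼? literals C) Cs
∈-insert⁻ p (mkCNF Cs d) C∈ | yes u | yes _ = inj₂ C∈
∈-insert⁻ p (mkCNF Cs d) (here refl) | yes u | no _ = inj₁ refl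
∈-insert⁻ p (mkCNF Cs d) (there C∈) | yes u | no _ = inj₂ C∈

∈-insert⁺ʳ : ∀ {C} p F → C ∈ clauses F → C ∈ clauses (insert p F)
∈-insert⁺ʳ p (mkCNF Cs d) C∈ with unique? p
... | no _ = C∈
... | yes u with any? (λ C → p ∼? literals C) Cs
...   | yes _ = C∈
...   | no _ = there C∈

∈-insert⁺ˡ : ∀ p F → Unique (map var p) → ∃[ C ] (C ∈ clauses (insert p F) × p ∼[ set ] literals C)
∈-insert⁺ˡ p (mkCNF Cs d) u with unique? p
... | no ¬u = contradiction u ¬u
... | yes u with any? (λ C → p ∼? literals C) Cs
...   | yes old = find old
...   | no _ = mkClause p u , here refl , ∼-refl

∈-toCNF⁻ : ∀ {C} ps → C ∈ clauses (toCNF ps) → literals C ∈ ps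
∈-toCNF⁻ (p ∷ ps) C∈ = [ here , there ∘ ∈-toCNF⁻ ps ]′ (∈-insert⁻ p (toCNF ps) C∈)

∈-toCNF⁺ : ∀ {p ps} → p ∈ ps → Unique (map var p) → ∃[ C ] (C ∈ clauses (toCNF ps) × p ∼[ set ] literals C)
∈-toCNF⁺ {p} {_ ∷ ps} (here refl) u = ∈-insert⁺ˡ p (toCNF ps) u
∈-toCNF⁺ {p} {q ∷ ps} (there p∈) u with ∈-toCNF⁺ p∈ u
... | C , C∈ , e = C , ∈-insert⁺ʳ q (toCNF ps) C∈ , λ {z} → e {z}

size-insert : ∀ p F → size (insert p F) ≤ length p + size F
size-insert p (mkCNF Cs d) with unique? p
... | no _ = m≤n+m _ (length p)
... | yes u with any? (λ C → p ∼? literals C) Cs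
...   | yes _ = m≤n+m _ (length p)
...   | no _ = ≤-refl

size-toCNF : ∀ ps → size (toCNF ps) ≤ foldr (λ p → length p +_) 0 ps
size-toCNF [] = z≤n
size-toCNF (p ∷ ps) = ≤-trans (size-insert p (toCNF ps)) (+-monoʳ-≤ (length p) (size-toCNF ps))

-- Decidability of refutation in bounded width

occurring : CNF → List Literal
occurring F = concatMap literals (clauses F)

length-occurring : ∀ F → length (occurring F) ≡ size F
length-occurring F = go (clauses F)
  where
  go : ∀ Cs → length (concatMap literals Cs) ≡ foldr _+_ 0 (map width Cs)
  go [] = refl
  go (C ∷ Cs) = trans (length-++ (literals C)) (cong (width C +_) (go Cs))

-- A resolvent takes all its literals from its premises.
derived-occurring : ∀ {F π} → Derivation F π → All (λ C → literals C ⊆ occurring F) π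
derived-occurring {F} = Derivation-preserves (λ C → literals C ⊆ occurring F)
  (λ {C} A∈ e l∈ → ∈-concat⁺′ (Equivalence.to e l∈) (∈-map⁺ literals A∈))
  (λ {D} {E} {R} res D⊆ E⊆ l∈R →
    let x , r = Resolves⇒Resolvent {D} {E} {R} res in
    [ D⊆ ∘ proj₁ , E⊆ ∘ proj₁ ]′ (Resolvent.source r l∈R))

sublists : ∀ {A : Set} → List A → List (List A)
sublists [] = [ [] ]
sublists (x ∷ xs) = map (x ∷_) (sublists xs) ++ sublists xs

filter-∈-sublists : ∀ {A : Set} {P : A → Set} (P? : ∀ x → Dec (P x)) xs → filter P? xs ∈ sublists xs
filter-∈-sublists P? [] = here refl
filter-∈-sublists P? (x ∷ xs) with P? x
... | yes _ = ∈-++⁺ˡ (∈-map⁺ (x ∷_) (filter-∈-sublists P? xs))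
... | no _ = ∈-++⁺ʳ (map (x ∷_) (sublists xs)) (filter-∈-sublists P? xs)

candidates : CNF → List Clause
candidates F = clauses (toCNF (sublists (deduplicate _≟ˡ_ (occurring F))))

-- Listed in the order of the deduplicated literals of F, the literals of C form one of the
-- sublists; that their variables are distinct is inherited from C.
candidate : ∀ F C → literals C ⊆ occurring F → ∃[ C′ ] (C′ ∈ candidates F × C ≈ C′)
candidate F C C⊆ = let C′ , C′∈ , e = ∈-toCNF⁺ (filter-∈-sublists (_∈? literals C) Λ) unique
                   in C′ , C′∈ , ∼-trans C∼p e
  where
  Λ p : List Literal
  Λ = deduplicate _≟ˡ_ (occurring F)
  p = filter (_∈? literals C) Λ
  C∼p : literals C ∼[ set ] p
  C∼p = mk⇔ (λ l∈ → ∈-filter⁺ (_∈? literals C) (∈-deduplicate⁺ _≟ˡ_ (C⊆ l∈)) l∈)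
            (λ l∈ → proj₂ (∈-filter⁻ (_∈? literals C) {xs = Λ} l∈))
  unique : Unique (map var p)
  unique = injective-unique-map (Unique.filter⁺ (_∈? literals C) (deduplicate-! _≟ˡ_ (occurring F)))
    λ l∈ m∈ → unique-map-injective (Clause.distinct C) (Equivalence.from C∼p l∈) (Equivalence.from C∼p m∈)

-- While some clause of Cs is justified, it moves from Cs to the derivation, so k rounds suffice.
-- When this stops, no remaining clause is justified, which is the closure property.
saturate : ∀ {F w} k Cs π → length Cs ≤ k → Narrow w Cs → Derivation F π → Narrow w π →
  ∃[ σ ] (π ⊆ σ × Derivation F σ × Narrow w σ × (∀ {C} → C ∈ Cs → Justified F σ C → C ∈ σ))
saturate {F} k Cs π len ws d nπ with any? (justified? F π) Cs
... | no ¬j = π , id , d , nπ , λ C∈ j → contradiction (lose C∈ j) ¬j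
... | yes j with find j
... | C , C∈ , jC with ∈-∃++ C∈
saturate zero _ _ () _ _ _ | _ | _ | [] , _ , refl
saturate zero _ _ () _ _ _ | _ | _ | _ ∷ _ , _ , refl
saturate {F} {w} (suc k) Cs π len ws d nπ | yes j | C , C∈ , jC | as , bs , refl
  with saturate k (as ++ bs) (C ∷ π) len′ (All.tabulate (All.lookup ws ∘ widen)) (jC ∷ d) (All.lookup ws C∈ ∷ nπ)
  where
  widen : as ++ bs ⊆ as ++ [ C ] ++ bs
  widen z∈ = [ ∈-++⁺ˡ , ∈-++⁺ʳ as ∘ there ]′ (∈-++⁻ as z∈)
  len′ : length (as ++ bs) ≤ k
  len′ = ≤-pred (begin
    suc (length (as ++ bs))      ≡⟨ cong suc (length-++ as) ⟩
    suc (length as + length bs)  ≡⟨ +-suc (length as) (length bs) ⟨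
    length as + length (C ∷ bs)  ≡⟨ length-++ as ⟨
    length (as ++ [ C ] ++ bs)   ≤⟨ len ⟩
    suc k                        ∎)
    where open ≤-Reasoning
... | σ , sub , dσ , nσ , closed = σ , sub ∘ there , dσ , nσ , closed′
  where
  closed′ : ∀ {C′} → C′ ∈ as ++ [ C ] ++ bs → Justified F σ C′ → C′ ∈ σ
  closed′ C′∈ j with ∈-++⁻ as C′∈
  ... | inj₁ C′∈as = closed (∈-++⁺ˡ C′∈as) j
  ... | inj₂ (here refl) = sub (here refl)
  ... | inj₂ (there C′∈bs) = closed (∈-++⁺ʳ as C′∈bs) j

NarrowRefutation : CNF → ℕ → Set
NarrowRefutation F w = ∃[ π ] (Refutes π F × W π ≤ w)

-- A refutation has to end with the empty clause, so the lines derived after it are cut off.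
refutation : ∀ {F w π C} → Derivation F π → Narrow w π → C ∈ π → C ≈ 𝟘 →
  ∃[ ρ ] (Refutes ρ F × W ρ ≤ w × length ρ ≤ length π)
refutation d@(_ ∷ _) n (here refl) e = _ , (d , _ , _ , refl , λ {z} → e {z}) , Narrow⇒W≤ n , ≤-refl
refutation (_ ∷ d) (_ ∷ n) (there C∈) e with refutation d n C∈ e
... | ρ , ref , W≤ , len = ρ , ref , W≤ , m≤n⇒m≤1+n len

narrowRefutation? : ∀ F w → Dec (NarrowRefutation F w)
narrowRefutation? F w with saturate (length Cs) Cs [] ≤-refl narrow [] []
  where
  Cs : List Clause
  Cs = filter (λ C → width C ≤? w) (candidates F)
  narrow : Narrow w Cs
  narrow = All.tabulate (λ C∈ → proj₂ (∈-filter⁻ (λ C → width C ≤? w) {xs = candidates F} C∈))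
... | σ , _ , d , n , closed = map′
  (λ any → let C , C∈ , e = find any ; ρ , ref , W≤ , _ = refutation d n C∈ (λ {z} → e {z}) in ρ , ref , W≤)
  (λ where
    (π , (dπ , C , π′ , refl , C≈𝟘) , W≤) →
      let C′ , C′∈ , e = All.head (complete dπ (W≤⇒Narrow π W≤))
      in lose {P = _≈ 𝟘} C′∈ (∼-trans (∼-sym e) C≈𝟘))
  (any? (λ C → literals C ∼? []) σ)
  where
  -- By induction, σ contains a representative of each line of any narrow derivation: the
  -- representative is a candidate, it is justified by earlier representatives, and σ is closed.
  complete : ∀ {π} → Derivation F π → Narrow w π → All (λ C → ∃[ C′ ] (C′ ∈ σ × C ≈ C′)) π
  complete [] [] = []
  complete {C ∷ π} dC@(j ∷ d) (C≤w ∷ n)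
    with complete d n | candidate F C (All.head (derived-occurring dC))
  ... | ih | C′ , C′∈ , e =
    (C′ , closed (∈-filter⁺ (λ C → width C ≤? w) C′∈ (subst (_≤ w) (≈-width {C} {C′} e) C≤w))
                 (justified-cong (All.lookup ih) e j)
        , λ {z} → e {z}) ∷ ih

minimal-width : ∀ {F u} → NarrowRefutation F u → ∃[ w ] (W[ F ⊢𝟘]≡ w)
minimal-width {F} r with least (narrowRefutation? F) r
... | w , (π , ref , W≤) , min =
  w , (π , ref , ≤-antisym W≤ (min (W π) (π , ref , ≤-refl))) , λ π′ ref′ → min (W π′) (π′ , ref′ , ≤-refl)

-- Derivations of bounded width with a count of their lines

Consistent : List Literal → Set
Consistent M = ∀ {l m} → l ∈ M → m ∈ M → var l ≡ var m → l ≡ m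

consistent-∷ : ∀ {l M} → var l ∉ map var M → Consistent M → Consistent (l ∷ M)
consistent-∷ _ _ (here refl) (here refl) _ = refl
consistent-∷ x∉ _ (here refl) (there m∈) e = contradiction (subst (_∈ _) (sym e) (∈-map⁺ var m∈)) x∉
consistent-∷ x∉ _ (there l∈) (here refl) e = contradiction (subst (_∈ _) e (∈-map⁺ var l∈)) x∉
consistent-∷ _ c (there l∈) (there m∈) e = c l∈ m∈ e

module Extending (F : CNF) (w : ℕ) where

  record Proof : Set where
    constructor mkProof
    field
      lines      : List Clause
      derivation : Derivation F lines
      narrow     : Narrow w lines

  open Proof public

  infix 4 _⊑[_]_ _⊢[_]_

  -- Containment makes weakening free: the clause actually derived may be stronger than the intended
  -- one.
  record Yields (P : Proof) (M : List Literal) : Set where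
    constructor yields
    field
      {clause} : Clause
      clause∈  : clause ∈ lines P
      clause⊆  : literals clause ⊆ M

  record _⊑[_]_ (P : Proof) (k : ℕ) (Q : Proof) : Set where
    constructor extends
    field
      lines⊆   : lines P ⊆ lines Q
      lines≤   : length (lines Q) ≤ k + length (lines P)

  -- Derivations extend a common P, so that a line derived once is reused and counted once.
  _⊢[_]_ : Proof → ℕ → List Literal → Set
  P ⊢[ k ] M = ∃[ Q ] (P ⊑[ k ] Q × Yields Q M)

  ∅ : Proof
  ∅ = mkProof [] [] []

  ⊑-refl : ∀ {P} → P ⊑[ 0 ] P
  ⊑-refl = extends id ≤-refl

  ⊑-trans : ∀ {P Q R j k} → P ⊑[ j ] Q → Q ⊑[ k ] R → P ⊑[ j + k ] R
  ⊑-trans {P} {Q} {R} {j} {k} (extends s a) (extends t b) = extends (t ∘ s) (begin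
    length (lines R)            ≤⟨ b ⟩
    k + length (lines Q)        ≤⟨ +-monoʳ-≤ k a ⟩
    k + (j + length (lines P))  ≡⟨ +-assoc k j _ ⟨
    k + j + length (lines P)    ≡⟨ cong (_+ length (lines P)) (+-comm k j) ⟩
    j + k + length (lines P)    ∎)
    where open ≤-Reasoning

  ⊑-≤ : ∀ {P Q j k} → j ≤ k → P ⊑[ j ] Q → P ⊑[ k ] Q
  ⊑-≤ j≤k (extends s a) = extends s (≤-trans a (+-monoˡ-≤ _ j≤k))

  yields-mono : ∀ {P Q k M} → P ⊑[ k ] Q → Yields P M → Yields Q M
  yields-mono (extends s _) (yields C∈ C⊆) = yields (s C∈) C⊆

  yields-⊆ : ∀ {P M N} → M ⊆ N → Yields P M → Yields P N
  yields-⊆ M⊆N (yields C∈ C⊆) = yields C∈ (M⊆N ∘ C⊆)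

  known : ∀ {P M} → Yields P M → P ⊢[ 0 ] M
  known {P} y = P , ⊑-refl , y

  ⊢-cast : ∀ {P j k M} → j ≡ k → P ⊢[ j ] M → P ⊢[ k ] M
  ⊢-cast refl d = d

  infixl 1 _>>=_
  _>>=_ : ∀ {P j k M N} → P ⊢[ j ] M → (∀ {Q} → P ⊑[ j ] Q → Yields Q M → Q ⊢[ k ] N) → P ⊢[ j + k ] N
  (Q , P⊑Q , y) >>= f with f P⊑Q y
  ... | R , Q⊑R , z = R , ⊑-trans P⊑Q Q⊑R , z

  append : ∀ {P} C → Justified F (lines P) C → width C ≤ w → ∀ {M} → literals C ⊆ M → P ⊢[ 1 ] M
  append {P} C j C≤w C⊆ = mkProof (C ∷ lines P) (j ∷ derivation P) (C≤w ∷ narrow P) ,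
    extends there ≤-refl , yields (here refl) C⊆

  Contains : List Literal → Set
  Contains p = ∃[ A ] (A ∈ clauses F × literals A ⊆ p)

  start : ∀ {P p M} → Contains p → length p ≤ w → p ⊆ M → P ⊢[ 1 ] M
  start (A , A∈ , A⊆) p≤w p⊆ = append A (axiom (lose {P = A ≈_} A∈ (mk⇔ id id)))
    (≤-trans (unique-length (literals-unique A) A⊆) p≤w) (p⊆ ∘ A⊆)

  -- A premise without its pivot already lies in M, and no line is added. Otherwise the resolvent is
  -- listed inside the deduplicated M, so its width is bounded by `length M`; consistency of M
  -- excludes complementary literals.
  branch : ∀ {P x M} → Consistent M → x ∉ map var M → length M ≤ w →
    Yields P (pos x ∷ M) → Yields P (neg x ∷ M) → P ⊢[ 1 ] M
  branch {P} {x} {M} con x∉M M≤w (yields {D} D∈ D⊆) (yields {E} E∈ E⊆) with pos x ∈? literals D | neg x ∈? literals E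
  ... | no p∉ | _ = P , extends id (n≤1+n _) , yields D∈ λ {l} l∈ → drop l∈ (D⊆ l∈)
    where
    drop : ∀ {l} → l ∈ literals D → l ∈ pos x ∷ M → l ∈ M
    drop l∈ (here refl) = contradiction l∈ p∉
    drop l∈ (there l∈M) = l∈M
  ... | yes _ | no n∉ = P , extends id (n≤1+n _) , yields E∈ λ {l} l∈ → drop l∈ (E⊆ l∈)
    where
    drop : ∀ {l} → l ∈ literals E → l ∈ neg x ∷ M → l ∈ M
    drop l∈ (here refl) = contradiction l∈ n∉
    drop l∈ (there l∈M) = l∈M
  ... | yes p∈ | yes n∈ = append R
      (resolve D∈ E∈ (Resolvent⇒Resolves {D} {E} {R} (mkResolvent′ p∈ n∈ left right source)))
      (≤-trans (length-filter DE? (deduplicate _≟ˡ_ M)) (≤-trans (length-deduplicate _≟ˡ_ M) M≤w))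
      (∈-deduplicate⁻ _≟ˡ_ M ∘ proj₁ ∘ ∈-filter⁻ DE? {xs = deduplicate _≟ˡ_ M})
    where
    DE? : ∀ l → Dec (l ∈ literals D ⊎ l ∈ literals E)
    DE? l = (l ∈? literals D) ⊎-dec (l ∈? literals E)
    ls : List Literal
    ls = filter DE? (deduplicate _≟ˡ_ M)
    ls⊆M : ls ⊆ M
    ls⊆M l∈ = ∈-deduplicate⁻ _≟ˡ_ M (proj₁ (∈-filter⁻ DE? {xs = deduplicate _≟ˡ_ M} l∈))
    R : Clause
    R = mkClause ls (injective-unique-map (Unique.filter⁺ DE? (deduplicate-! _≟ˡ_ M))
      λ l∈ m∈ → con (ls⊆M l∈) (ls⊆M m∈))
    left : ∀ {l} → l ∈ literals D → l ≡ pos x ⊎ l ∈ ls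
    left l∈ with D⊆ l∈
    ... | here e = inj₁ e
    ... | there l∈M = inj₂ (∈-filter⁺ DE? (∈-deduplicate⁺ _≟ˡ_ l∈M) (inj₁ l∈))
    right : ∀ {l} → l ∈ literals E → l ≡ neg x ⊎ l ∈ ls
    right l∈ with E⊆ l∈
    ... | here e = inj₁ e
    ... | there l∈M = inj₂ (∈-filter⁺ DE? (∈-deduplicate⁺ _≟ˡ_ l∈M) (inj₂ l∈))
    source : ∀ {l} → l ∈ ls → (l ∈ literals D × l ≢ pos x) ⊎ (l ∈ literals E × l ≢ neg x)
    source l∈ = Sum.map (_, λ { refl → x∉M (∈-map⁺ var (ls⊆M l∈)) }) (_, λ { refl → x∉M (∈-map⁺ var (ls⊆M l∈)) })
      (proj₂ (∈-filter⁻ DE? {xs = deduplicate _≟ˡ_ M} l∈))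

  for-below : ∀ {P} n c (M : ℕ → List Literal) →
    (∀ {i} → i < n → ∀ {Q k} → P ⊑[ k ] Q → Q ⊢[ c ] M i) →
    ∃[ Q ] (P ⊑[ n * c ] Q × (∀ {i} → i < n → Yields Q (M i)))
  for-below {P} zero c M f = P , ⊑-refl , λ ()
  for-below {P} (suc n) c M f with for-below n c M (λ i<n → f (m<n⇒m<1+n i<n))
  ... | Q , P⊑Q , ys with f ≤-refl P⊑Q
  ... | R , Q⊑R , y = R , subst (P ⊑[_] R) (+-comm (n * c) c) (⊑-trans P⊑Q Q⊑R) , ys′
    where
    ys′ : ∀ {i} → i < suc n → Yields R (M i)
    ys′ {i} i<1+n with m<1+n⇒m<n∨m≡n i<1+n
    ... | inj₁ i<n = yields-mono Q⊑R (ys i<n)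
    ... | inj₂ refl = y

  yields-[]⇒refutation : ∀ {P} → Yields P [] →
    ∃[ ρ ] (Refutes ρ F × W ρ ≤ w × length ρ ≤ length (lines P))
  yields-[]⇒refutation {P} (yields C∈ C⊆) =
    refutation (derivation P) (narrow P) C∈ (mk⇔ C⊆ λ ())

-- The variables

diagonalNext : ℕ × ℕ → ℕ × ℕ
diagonalNext (zero , b)  = suc b , 0
diagonalNext (suc a , b) = a , suc b

unpair : ℕ → ℕ × ℕ
unpair zero    = 0 , 0
unpair (suc n) = diagonalNext (unpair n)

-- The diagonal enumeration is run backwards: `(a , suc b)` comes after `(suc a , b)`, and
-- `(suc a , 0)` after `(0 , a)` on the preceding diagonal.
unpair-surjective : ∀ s a b → a + b ≡ s → ∃[ n ] (unpair n ≡ (a , b))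
unpair-surjective zero zero zero _ = 0 , refl
unpair-surjective (suc s) (suc a) zero e =
  let n , eq = unpair-surjective s 0 a (trans (sym (+-identityʳ a)) (suc-injective e)) in suc n , cong diagonalNext eq
unpair-surjective s a (suc b) e =
  let n , eq = unpair-surjective s (suc a) b (trans (sym (+-suc a b)) e) in suc n , cong diagonalNext eq

-- prec i j says that i precedes j. Every element j has a predecessor, its witness,
-- and below j i says that the witness of j is less than i as a number. The variable
-- x is replaced by half false x ⊕ half true x in the hard part of the formula.
data Var : Set where
  prec below : ℕ → ℕ → Var
  half       : Bool → Variable → Var
  pad        : ℕ → Var

-- All remaining tags decode to padding, so every variable has a meaning and assignments can be
-- defined by cases on `Var`.
decodeTagged : ℕ × ℕ → Var
decodeTagged (0 , p) = let i , j = unpair p in prec i j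
decodeTagged (1 , p) = let j , i = unpair p in below j i
decodeTagged (2 , x) = half false x
decodeTagged (3 , x) = half true x
decodeTagged (suc (suc (suc (suc _))) , i) = pad i

decode : Variable → Var
decode = decodeTagged ∘ unpair

abstract
  pair : ℕ → ℕ → ℕ
  pair a b = proj₁ (unpair-surjective (a + b) a b refl)

  unpair-pair : ∀ a b → unpair (pair a b) ≡ (a , b)
  unpair-pair a b = proj₂ (unpair-surjective (a + b) a b refl)

code : Var → Variable
code (prec i j)     = pair 0 (pair i j)
code (below j i)    = pair 1 (pair j i)
code (half false x) = pair 2 x
code (half true x)  = pair 3 x
code (pad i)        = pair 4 i

decode-code : ∀ v → decode (code v) ≡ v
decode-code (prec i j) rewrite unpair-pair 0 (pair i j) | unpair-pair i j = refl
decode-code (below j i) rewrite unpair-pair 1 (pair j i) | unpair-pair j i = refl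
decode-code (half false x) rewrite unpair-pair 2 x = refl
decode-code (half true x) rewrite unpair-pair 3 x = refl
decode-code (pad i) rewrite unpair-pair 4 i = refl

code-injective : ∀ v w → code v ≡ code w → v ≡ w
code-injective v w e = trans (sym (decode-code v)) (trans (cong decode e) (decode-code w))

≢-code : ∀ v w → v ≢ w → code v ≢ code w
≢-code v w v≢w e = v≢w (code-injective v w e)

x⁺ x⁻ y⁺ y⁻ : ℕ → ℕ → Literal
x⁺ i j = pos (code (prec i j))
x⁻ i j = neg (code (prec i j))
y⁺ j i = pos (code (below j i))
y⁻ j i = neg (code (below j i))

-- The ordering principle

-- If k is i or j, then the second list is not a clause, and toCNF drops it.
orderingAxioms : ℕ → ℕ → ℕ → ℕ → List (List Literal)
orderingAxioms m i j k =
  (x⁻ k k ∷ []) ∷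
  (x⁻ i k ∷ x⁻ k j ∷ x⁺ i j ∷ []) ∷
  (y⁻ k 0 ∷ []) ∷
  (y⁺ k m ∷ []) ∷
  (y⁻ k (suc i) ∷ y⁺ k i ∷ x⁺ i k ∷ []) ∷ []

ordering : ℕ → List (List Literal)
ordering m = concatMap (λ i → concatMap (λ j → concatMap (orderingAxioms m i j) (upTo m)) (upTo m)) (upTo m)

∈-ordering⁺ : ∀ {m i j k p} → i < m → j < m → k < m → p ∈ orderingAxioms m i j k → p ∈ ordering m
∈-ordering⁺ {m} {i} {j} i< j< k< p∈ =
  ∈-concatMap⁺ (λ i → concatMap (λ j → concatMap (orderingAxioms m i j) (upTo m)) (upTo m)) (lose (∈-upTo⁺ i<)
    (∈-concatMap⁺ (λ j → concatMap (orderingAxioms m i j) (upTo m)) (lose (∈-upTo⁺ j<)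
      (∈-concatMap⁺ (orderingAxioms m i j) (lose (∈-upTo⁺ k<) p∈)))))

∈-ordering⁻ : ∀ m {p} → p ∈ ordering m → ∃[ i ] ∃[ j ] ∃[ k ] (p ∈ orderingAxioms m i j k)
∈-ordering⁻ m p∈ with find (∈-concatMap⁻ (λ i → concatMap (λ j → concatMap (orderingAxioms m i j) (upTo m)) (upTo m)) {xs = upTo m} p∈)
... | i , _ , p∈i with find (∈-concatMap⁻ (λ j → concatMap (orderingAxioms m i j) (upTo m)) {xs = upTo m} p∈i)
... | j , _ , p∈j with find (∈-concatMap⁻ (orderingAxioms m i j) {xs = upTo m} p∈j)
... | k , _ , p∈k = i , j , k , p∈k

-- The clause "some element less than k precedes j". For k = m it is the long axiom of the usual
-- ordering principle, for which the chain of `below` variables stands.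
row : ℕ → ℕ → List Literal
row k j = map (λ i → x⁺ i j) (upTo k)

∈-row⁺ : ∀ {i k j} → i < k → x⁺ i j ∈ row k j
∈-row⁺ {j = j} i<k = ∈-map⁺ (λ i → x⁺ i j) (∈-upTo⁺ i<k)

∈-row⁻ : ∀ {k j l} → l ∈ row k j → ∃[ i ] (i < k × l ≡ x⁺ i j)
∈-row⁻ {j = j} l∈ = let i , i∈ , e = ∈-map⁻ (λ i → x⁺ i j) l∈ in i , ∈-upTo⁻ i∈ , e

row-mono : ∀ {k k′ j} → k ≤ k′ → row k j ⊆ row k′ j
row-mono k≤k′ l∈ with ∈-row⁻ l∈
... | i , i<k , refl = ∈-row⁺ (≤-trans i<k k≤k′)

length-row : ∀ k j → length (row k j) ≡ k
length-row k j = trans (length-map _ (upTo k)) (length-upTo k)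

-- A short and narrow refutation of the ordering principle

module OrderingRefutation (F : CNF) (w m : ℕ) (2m+1≤w : 2 * m + 1 ≤ w) (1≤m : 1 ≤ m)
  (has : ∀ {i j k p} → i < m → j < m → k < m → p ∈ orderingAxioms m i j k → Unique (map var p) →
    ∃[ A ] (A ∈ clauses F × literals A ⊆ p)) where

  open Extending F w

  3≤w : 3 ≤ w
  3≤w = ≤-trans (+-monoˡ-≤ 1 (*-monoʳ-≤ 2 1≤m)) 2m+1≤w

  1≤w : 1 ≤ w
  1≤w = ≤-trans (s≤s z≤n) 3≤w

  m+1≤w : m + 1 ≤ w
  m+1≤w = ≤-trans (+-monoˡ-≤ 1 (m≤m+n m (m + 0))) 2m+1≤w

  irreflexivity : ∀ {P k M} → k < m → x⁻ k k ∈ M → P ⊢[ 1 ] M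
  irreflexivity k<m l∈ = start (has k<m k<m k<m (here refl) ([] ∷ [])) 1≤w λ where (here refl) → l∈

  transitivity : ∀ {P i j k M} → i < k → j < k → k < m → x⁻ i k ∈ M → x⁻ k j ∈ M → x⁺ i j ∈ M → P ⊢[ 1 ] M
  transitivity {i = i} {j} {k} i<k j<k k<m a∈ b∈ c∈ = start
    (has (<-trans i<k k<m) (<-trans j<k k<m) k<m (there (here refl))
      ((≢-code (prec i k) (prec k j) (λ { refl → <-irrefl refl i<k })
        ∷ ≢-code (prec i k) (prec i j) (λ { refl → <-irrefl refl j<k }) ∷ [])
      ∷ (≢-code (prec k j) (prec i j) (λ { refl → <-irrefl refl i<k }) ∷ []) ∷ [] ∷ []))
    3≤w λ where (here refl) → a∈ ; (there (here refl)) → b∈ ; (there (there (here refl))) → c∈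

  first : ∀ {P j M} → j < m → y⁻ j 0 ∈ M → P ⊢[ 1 ] M
  first j<m l∈ = start (has j<m j<m j<m (there (there (here refl))) ([] ∷ [])) 1≤w λ where (here refl) → l∈

  last : ∀ {P j M} → j < m → y⁺ j m ∈ M → P ⊢[ 1 ] M
  last j<m l∈ = start (has j<m j<m j<m (there (there (there (here refl)))) ([] ∷ [])) 1≤w λ where (here refl) → l∈

  witness : ∀ {P i j M} → i < m → j < m → y⁻ j (suc i) ∈ M → y⁺ j i ∈ M → x⁺ i j ∈ M → P ⊢[ 1 ] M
  witness {i = i} {j} i<m j<m a∈ b∈ c∈ = start
    (has i<m i<m j<m (there (there (there (there (here refl)))))
      ((≢-code (below j (suc i)) (below j i) (λ ()) ∷ ≢-code (below j (suc i)) (prec i j) (λ ()) ∷ [])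
      ∷ (≢-code (below j i) (prec i j) (λ ()) ∷ []) ∷ [] ∷ []))
    3≤w λ where (here refl) → a∈ ; (there (here refl)) → b∈ ; (there (there (here refl))) → c∈

  row-∌ : ∀ v {k j} → (∀ i → i < k → v ≢ prec i j) → code v ∉ map var (row k j)
  row-∌ v {j = j} ≢ x∈ with ∈-map⁻ var x∈
  ... | l , l∈ , e with ∈-row⁻ l∈
  ...   | i , i<k , refl = ≢ i i<k (code-injective v (prec i j) e)

  row-consistent : ∀ {k j} → Consistent (row k j)
  row-consistent l∈ m∈ e with ∈-row⁻ l∈ | ∈-row⁻ m∈
  ... | i , _ , refl | i′ , _ , refl = cong pos e

  rows-consistent : ∀ {k j k′ j′} → Consistent (row k j ++ row k′ j′)
  rows-consistent {k} {j} l∈ m∈ e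
    with Sum.map ∈-row⁻ ∈-row⁻ (∈-++⁻ (row k j) l∈) | Sum.map ∈-row⁻ ∈-row⁻ (∈-++⁻ (row k j) m∈)
  ... | inj₁ (_ , _ , refl) | inj₁ (_ , _ , refl) = cong pos e
  ... | inj₁ (_ , _ , refl) | inj₂ (_ , _ , refl) = cong pos e
  ... | inj₂ (_ , _ , refl) | inj₁ (_ , _ , refl) = cong pos e
  ... | inj₂ (_ , _ , refl) | inj₂ (_ , _ , refl) = cong pos e

  rows-∌ : ∀ v {k j k′ j′} → (∀ i → i < k → v ≢ prec i j) → (∀ i → i < k′ → v ≢ prec i j′) →
    code v ∉ map var (row k j ++ row k′ j′)
  rows-∌ v {k} {j} {k′} {j′} ≢ ≢′ x∈ with ∈-map⁻ var x∈
  ... | l , l∈ , e with Sum.map ∈-row⁻ ∈-row⁻ (∈-++⁻ (row k j) l∈)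
  ...   | inj₁ (i , i<k , refl) = ≢ i i<k (code-injective v (prec i j) e)
  ...   | inj₂ (i , i<k′ , refl) = ≢′ i i<k′ (code-injective v (prec i j′) e)

  -- Invariant along the chain: if the witness of j is less than i, some element less than i
  -- precedes j. Each link costs one axiom and one resolution.
  witness-below : ∀ {P j} → j < m → ∀ i → i ≤ m → P ⊢[ 1 + i * 2 ] (y⁻ j i ∷ row i j)
  witness-below j<m zero _ = first j<m (here refl)
  witness-below {P} {j} j<m (suc i) i<m = ⊢-cast (cong suc (+-comm (i * 2) 2))
    (witness-below j<m i (<⇒≤ i<m) >>= λ _ A →
     witness i<m j<m (there (here refl)) (here refl) (there (there (∈-row⁺ (n<1+n i)))) >>= λ ext B →
     branch
       (consistent-∷ (row-∌ (below j (suc i)) λ _ _ ()) row-consistent)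
       (λ { (here e) → case code-injective (below j i) (below j (suc i)) e of λ () ; (there x∈) → row-∌ (below j i) (λ _ _ ()) x∈ })
       (≤-trans (≤-reflexive (trans (cong suc (length-row (suc i) j)) (+-comm 1 (suc i))))
         (≤-trans (+-monoˡ-≤ 1 i<m) m+1≤w))
       B
       (yields-⊆ (λ { (here refl) → here refl ; (there l∈) → there (there (row-mono (n≤1+n i) l∈)) })
         (yields-mono ext A)))

  non-minimal : ∀ {P j} → j < m → P ⊢[ 1 + m * 2 + 2 ] row m j
  non-minimal {j = j} j<m =
    witness-below j<m m ≤-refl >>= λ _ A →
    last j<m (here refl) >>= λ ext B →
    branch row-consistent (row-∌ (below j m) λ _ _ ())
      (≤-trans (≤-reflexive (length-row m j)) (≤-trans (m≤m+n m 1) m+1≤w))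
      B (yields-mono ext A)

  diagonal : ∀ {P k} → k < m → Yields P (row (suc k) k) → P ⊢[ 2 ] row k k
  diagonal {k = k} k<m A =
    irreflexivity k<m (here refl) >>= λ ext B →
    branch row-consistent (row-∌ (prec k k) λ { i i<k refl → <-irrefl refl i<k })
      (≤-trans (≤-reflexive (length-row k k)) (≤-trans (<⇒≤ k<m) (≤-trans (m≤m+n m 1) m+1≤w)))
      (yields-⊆ (λ l∈ → split (∈-row⁻ l∈)) (yields-mono ext A)) B
    where
    split : ∀ {l} → ∃[ i ] (i < suc k × l ≡ x⁺ i k) → l ∈ x⁺ k k ∷ row k k
    split (i , i<1+k , refl) with m<1+n⇒m<n∨m≡n i<1+k
    ... | inj₁ i<k = there (∈-row⁺ i<k)
    ... | inj₂ refl = here refl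

  row-suc : ∀ {k j l} → l ∈ row (suc k) j → l ≡ x⁺ k j ⊎ l ∈ row k j
  row-suc l∈ with ∈-row⁻ l∈
  ... | i , i<1+k , refl with m<1+n⇒m<n∨m≡n i<1+k
  ...   | inj₁ i<k = inj₂ (∈-row⁺ i<k)
  ...   | inj₂ refl = inj₁ refl

  -- If k precedes j, so does the predecessor that k has among the smaller numbers. The literals of
  -- `row k k` are traded by transitivity, from the last one down, for literals of `row k j`; e
  -- counts the trades. Two rows standing side by side are the reason for the width `2 * m + 1`.
  shortcut : ∀ {P j k} → j < k → k < m → Yields P (row k k) →
    ∀ e i → e + i ≡ k → P ⊢[ e * 2 ] (x⁻ k j ∷ row k j ++ row i k)
  shortcut {j = j} {k} _ _ A zero i refl = known (yields-⊆ (there ∘ ∈-++⁺ʳ (row i j)) A)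
  shortcut {P} {j} {k} j<k k<m A (suc e) i e+i≡k = ⊢-cast (+-comm (e * 2) 2)
    (shortcut j<k k<m A e (suc i) (trans (+-suc e i) e+i≡k) >>= λ _ B →
     transitivity i<k j<k k<m (here refl) (there (here refl)) (there (there (∈-++⁺ˡ (∈-row⁺ i<k)))) >>= λ ext C →
     branch consistent i∌ short (yields-⊆ widen (yields-mono ext B)) C)
    where
    i<k : i < k
    i<k = subst (i <_) e+i≡k (s≤s (m≤n+m i e))
    consistent : Consistent (x⁻ k j ∷ row k j ++ row i k)
    consistent = consistent-∷
      (rows-∌ (prec k j) {k} (λ { _ i<k refl → <-irrefl refl i<k }) (λ { _ _ refl → <-irrefl refl j<k }))
      (rows-consistent {k})
    i∌ : code (prec i k) ∉ map var (x⁻ k j ∷ row k j ++ row i k)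
    i∌ (here e) with code-injective (prec i k) (prec k j) e
    ... | refl = <-irrefl refl j<k
    i∌ (there x∈) = rows-∌ (prec i k) {k} (λ { _ _ refl → <-irrefl refl j<k }) (λ { _ i<i refl → <-irrefl refl i<i }) x∈
    short : length (x⁻ k j ∷ row k j ++ row i k) ≤ w
    short = begin
      suc (length (row k j ++ row i k))  ≡⟨ cong suc (trans (length-++ (row k j)) (cong₂ _+_ (length-row k j) (length-row i k))) ⟩
      suc (k + i)                        ≤⟨ s≤s (+-mono-≤ (<⇒≤ k<m) (<⇒≤ (<-trans i<k k<m))) ⟩
      suc (m + m)                        ≡⟨ cong (λ n → suc (m + n)) (+-identityʳ m) ⟨
      suc (2 * m)                        ≡⟨ +-comm 1 (2 * m) ⟩
      2 * m + 1                          ≤⟨ 2m+1≤w ⟩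
      w                                  ∎
      where open ≤-Reasoning
    widen : x⁻ k j ∷ row k j ++ row (suc i) k ⊆ x⁺ i k ∷ x⁻ k j ∷ row k j ++ row i k
    widen (here refl) = there (here refl)
    widen (there l∈) with ∈-++⁻ (row k j) l∈
    ... | inj₁ l∈ˡ = there (there (∈-++⁺ˡ l∈ˡ))
    ... | inj₂ l∈ʳ with row-suc l∈ʳ
    ...   | inj₁ refl = here refl
    ...   | inj₂ l∈ʳ′ = there (there (∈-++⁺ʳ (row k j) l∈ʳ′))

  shorten : ∀ {P j k} → j < k → k < m → Yields P (row k k) → Yields P (row (suc k) j) → P ⊢[ k * 2 + 1 ] row k j
  shorten {j = j} {k} j<k k<m A B =
    shortcut j<k k<m A k 0 (+-identityʳ k) >>= λ ext C →
    branch row-consistent (row-∌ (prec k j) λ { i i<k refl → <-irrefl refl i<k })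
      (≤-trans (≤-reflexive (length-row k j)) (≤-trans (<⇒≤ k<m) (≤-trans (m≤m+n m 1) m+1≤w)))
      (yields-⊆ ([ (λ { refl → here refl }) , there ]′ ∘ row-suc {k} {j}) (yields-mono ext B))
      (yields-⊆ (λ { (here refl) → here refl
                   ; (there l∈) → there ([ id , (λ ()) ]′ (∈-++⁻ (row k j) l∈)) }) C)

  abstract
    -- Two lines for the row of the removed element, and at most `m * 2 + 1` for each of the other
    -- rows.
    cost : ℕ
    cost = 2 + m * (m * 2 + 1)

    cost-≥ : ∀ {k} → k ≤ m → 2 + k * (k * 2 + 1) ≤ cost
    cost-≥ k≤m = +-monoʳ-≤ 2 (*-mono-≤ k≤m (+-monoˡ-≤ 1 (*-monoˡ-≤ 2 k≤m)))

    cost≡ : cost ≡ 2 + m * (m * 2 + 1)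
    cost≡ = refl

  -- The invariant of the refutation: the first k elements by themselves form an order without a
  -- minimal element.
  Rows : Proof → ℕ → Set
  Rows P k = ∀ {j} → j < k → Yields P (row k j)

  remove-last : ∀ {P k} → k < m → Rows P (suc k) → ∃[ Q ] (P ⊑[ cost ] Q × Rows Q k × Yields Q (row k k))
  remove-last {P} {k} k<m rows with diagonal k<m (rows {k} (n<1+n k))
  ... | Q , P⊑Q , A with for-below {Q} k (k * 2 + 1) (row k) each
    where
    each : ∀ {j} → j < k → ∀ {R n} → Q ⊑[ n ] R → R ⊢[ k * 2 + 1 ] row k j
    each {j} j<k Q⊑R = shorten j<k k<m (yields-mono Q⊑R A) (yields-mono Q⊑R (yields-mono P⊑Q (rows {j} (m<n⇒m<1+n j<k))))
  ... | R , Q⊑R , rows′ = R , ⊑-≤ (cost-≥ (<⇒≤ k<m)) (⊑-trans {j = 2} {k = k * (k * 2 + 1)} P⊑Q Q⊑R) , rows′ , yields-mono Q⊑R A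

  eliminate : ∀ {P} k → k < m → Rows P (suc k) → P ⊢[ suc k * cost ] []
  -- When only the element 0 is left, its row without itself is the empty clause.
  eliminate {P} zero k<m rows =
    let Q , P⊑Q , _ , y = remove-last {P} {zero} k<m rows
    in Q , ⊑-≤ {j = cost} {k = 1 * cost} (m≤m+n cost 0) P⊑Q , y
  eliminate {P} (suc k) k<m rows =
    let Q , P⊑Q , rows′ , _ = remove-last {P} {suc k} k<m rows
        R , Q⊑R , y = eliminate {Q} k (<-trans (n<1+n k) k<m) rows′
    in R , ⊑-trans {j = cost} {suc k * cost} P⊑Q Q⊑R , y

  refute : ∃[ ρ ] (Refutes ρ F × W ρ ≤ w × length ρ ≤ m * (1 + m * 2 + 2) + m * cost)
  refute =
    let Q , extends _ lenQ , rows = for-below {∅} m (1 + m * 2 + 2) (row m) (λ j<m _ → non-minimal j<m)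
        R , extends _ lenR , y = eliminate {Q} (pred m) (≤-reflexive m≡) (subst (Rows Q) (sym m≡) rows)
        ρ , ref , ≤w , len = yields-[]⇒refutation {R} y
    in ρ , ref , ≤w , total (length (lines Q)) lenQ (≤-trans len lenR)
    where
    m≡ : suc (pred m) ≡ m
    m≡ = suc-pred m {{>-nonZero 1≤m}}
    total : ∀ q {r} → q ≤ m * (1 + m * 2 + 2) + 0 → r ≤ suc (pred m) * cost + q →
      r ≤ m * (1 + m * 2 + 2) + m * cost
    total q {r} q≤ r≤ = begin
      r                                   ≤⟨ r≤ ⟩
      suc (pred m) * cost + q             ≡⟨ cong (λ k → k * cost + q) m≡ ⟩
      m * cost + q                        ≤⟨ +-monoʳ-≤ (m * cost) q≤ ⟩
      m * cost + (m * (1 + m * 2 + 2) + 0) ≡⟨ cong (m * cost +_) (+-identityʳ _) ⟩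
      m * cost + m * (1 + m * 2 + 2)      ≡⟨ +-comm (m * cost) _ ⟩
      m * (1 + m * 2 + 2) + m * cost      ∎
      where open ≤-Reasoning

-- Substituting exclusive ors

refuting : Literal → Bool
refuting (pos _) = false
refuting (neg _) = true

falsify : Variable → Bool → Literal
falsify x false = pos x
falsify x true  = neg x

var-falsify : ∀ x b → var (falsify x b) ≡ x
var-falsify x false = refl
var-falsify x true  = refl

-- The literals that are false when the two halves of var l have values c and
-- c xor refuting l, so that l is false.
halves : Literal → Bool → List Literal
halves l c = falsify (code (half false (var l))) c ∷ falsify (code (half true (var l))) (c xor refuting l) ∷ []

-- The conjunctive normal form of the substituted clause, with one clause for each choice of values
-- of the first halves.
lifts : List Literal → List (List Literal)
lifts [] = [ [] ]
lifts (l ∷ ls) = concatMap (λ c → map (halves l c ++_) (lifts ls)) (false ∷ true ∷ [])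

-- The member of `lifts` in which γ makes the choices. As they depend on the variable alone, the
-- literals shared by a resolvent and its premises are lifted alike.
liftBy : (Variable → Bool) → List Literal → List Literal
liftBy γ = concatMap (λ l → halves l (γ (var l)))

liftBy∈lifts : ∀ γ ls → liftBy γ ls ∈ lifts ls
liftBy∈lifts γ [] = here refl
liftBy∈lifts γ (l ∷ ls) = ∈-concatMap⁺ (λ c → map (halves l c ++_) (lifts ls))
  (lose (∈-bools (γ (var l))) (∈-map⁺ (halves l (γ (var l)) ++_) (liftBy∈lifts γ ls)))
  where
  ∈-bools : ∀ b → b ∈ false ∷ true ∷ []
  ∈-bools false = here refl
  ∈-bools true  = there (here refl)

∈-liftBy⁺ : ∀ {γ ls l l̂} → l ∈ ls → l̂ ∈ halves l (γ (var l)) → l̂ ∈ liftBy γ ls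
∈-liftBy⁺ {γ} l∈ l̂∈ = ∈-concatMap⁺ (λ l → halves l (γ (var l))) (lose l∈ l̂∈)

∈-liftBy⁻ : ∀ {γ l̂} ls → l̂ ∈ liftBy γ ls → ∃[ l ] (l ∈ ls × l̂ ∈ halves l (γ (var l)))
∈-liftBy⁻ {γ} ls l̂∈ = find (∈-concatMap⁻ (λ l → halves l (γ (var l))) {xs = ls} l̂∈)

var-halves : ∀ {l l̂} c → l̂ ∈ halves l c → ∃[ b ] (var l̂ ≡ code (half b (var l)))
var-halves c (here refl) = false , var-falsify _ c
var-halves {l} c (there (here refl)) = true , var-falsify _ (c xor refuting l)

half∈liftBy⁻ : ∀ {γ b x} ls → code (half b x) ∈ map var (liftBy γ ls) → x ∈ map var ls
half∈liftBy⁻ {γ} {b} {x} ls x∈ =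
  let l̂ , l̂∈ , e = ∈-map⁻ var x∈
      l , l∈ , l̂∈h = ∈-liftBy⁻ {γ} ls l̂∈
      b′ , e′ = var-halves {l} (γ (var l)) l̂∈h
  in subst (_∈ map var ls) (half-injective (code-injective (half b x) (half b′ (var l)) (trans e e′))) (∈-map⁺ var l∈)
  where
  half-injective : ∀ {b b′ x x′} → half b x ≡ half b′ x′ → x′ ≡ x
  half-injective refl = refl

length-liftBy : ∀ γ ls → length (liftBy γ ls) ≡ 2 * length ls
length-liftBy γ [] = refl
length-liftBy γ (l ∷ ls) = trans (cong (2 +_) (length-liftBy γ ls)) (sym (*-suc 2 (length ls)))

liftBy-unique : ∀ γ ls → Unique (map var ls) → Unique (map var (liftBy γ ls))
liftBy-unique γ [] _ = []
liftBy-unique γ (l ∷ ls) (l∉ ∷ u)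
  rewrite var-falsify (code (half false (var l))) (γ (var l))
        | var-falsify (code (half true (var l))) (γ (var l) xor refuting l) =
  (≢-code (half false (var l)) (half true (var l)) (λ ()) ∷ ∉liftBy false) ∷ ∉liftBy true ∷ liftBy-unique γ ls u
  where
  ∉liftBy : ∀ b → All (code (half b (var l)) ≢_) (map var (liftBy γ ls))
  ∉liftBy b = All.tabulate λ x∈ e →
    All.lookup l∉ (half∈liftBy⁻ {γ} {b} ls (subst (_∈ map var (liftBy γ ls)) (sym e) x∈)) refl

-- Lifting a narrow refutation through the substitution

_[_≔_] : (Variable → Bool) → Variable → Bool → Variable → Bool
(γ [ x ≔ c ]) y with y ≟ x
... | yes _ = c
... | no _  = γ y

≔-same : ∀ γ x c → (γ [ x ≔ c ]) x ≡ c
≔-same γ x c with x ≟ x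
... | yes _ = refl
... | no x≢x = contradiction refl x≢x

≔-other : ∀ γ {x} c {y} → y ≢ x → (γ [ x ≔ c ]) y ≡ γ y
≔-other γ {x} c {y} y≢x with y ≟ x
... | yes y≡x = contradiction y≡x y≢x
... | no _ = refl

resolvent-∌ : ∀ {x D E R} → Unique (map var D) → Unique (map var E) → Resolvent x D E R → x ∉ map var R
resolvent-∌ uD uE r x∈ with ∈-map⁻ var x∈
... | l , l∈ , refl with Resolvent.source r l∈
...   | inj₁ (l∈D , l≢) = l≢ (unique-map-injective uD l∈D (Resolvent.pos∈ r) refl)
...   | inj₂ (l∈E , l≢) = l≢ (unique-map-injective uE l∈E (Resolvent.neg∈ r) refl)

module Lifting (E F : CNF) (v w : ℕ) (2v+1≤w : 2 * v + 1 ≤ w)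
  (has : ∀ {A} → A ∈ clauses E → ∀ γ → ∃[ B ] (B ∈ clauses F × literals B ⊆ liftBy γ (literals A))) where

  open Extending F w

  -- The number of lines is left open: a clause has exponentially many lifts, and the lifted
  -- refutation serves only to bound the minimal width from above.
  Derivable : List Literal → Set
  Derivable M = ∀ P → ∃[ k ] (P ⊢[ k ] M)

  derivable-⊆ : ∀ {M N} → M ⊆ N → Derivable M → Derivable N
  derivable-⊆ M⊆N d P = let k , Q , P⊑Q , y = d P in k , Q , P⊑Q , yields-⊆ M⊆N y

  derivable-branch : ∀ {x M} → x ∉ map var M → Unique (map var M) → length M ≤ w →
    Derivable (pos x ∷ M) → Derivable (neg x ∷ M) → Derivable M
  derivable-branch x∉ u short d e P =
    let k , Q , P⊑Q , y = d P
        l , R , Q⊑R , z = e Q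
        S , R⊑S , t = branch {R} (unique-map-injective u) x∉ short (yields-mono Q⊑R y) z
    in k + l + 1 , S , ⊑-trans {j = k + l} {1} (⊑-trans {j = k} {l} P⊑Q Q⊑R) R⊑S , t

  Liftable : Clause → Set
  Liftable C = ∀ γ → Derivable (liftBy γ (literals C))

  lift-axiom : ∀ {A C} → A ∈ clauses E → C ≈ A → width C ≤ v → Liftable C
  lift-axiom {A} {C} A∈ e C≤v γ P = 1 , start (has A∈ γ) short λ l̂∈ →
    let l , l∈ , l̂∈h = ∈-liftBy⁻ {γ} (literals A) l̂∈ in ∈-liftBy⁺ {γ} (Equivalence.from e l∈) l̂∈h
    where
    short : length (liftBy γ (literals A)) ≤ w
    short = begin
      length (liftBy γ (literals A))  ≡⟨ length-liftBy γ (literals A) ⟩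
      2 * width A                     ≡⟨ cong (2 *_) (≈-width {C} {A} e) ⟨
      2 * width C                     ≤⟨ *-monoʳ-≤ 2 C≤v ⟩
      2 * v                           ≤⟨ m≤m+n (2 * v) 1 ⟩
      2 * v + 1                       ≤⟨ 2v+1≤w ⟩
      w                               ∎
      where open ≤-Reasoning

  -- The two halves of x are resolved upon in turn. Their values determine x, so in each of the four
  -- cases a lift of C or of D applies, with the value of the first half entered into γ. In between,
  -- one literal on the first half accompanies the lift of R; hence the 1 in `2 * v + 1`.
  lift-resolve : ∀ {C D R} x → Resolvent x (literals C) (literals D) (literals R) → width R ≤ v →
    Liftable C → Liftable D → Liftable R
  lift-resolve {C} {D} {R} x res R≤v liftC liftD γ =
    derivable-branch a∉M uM (≤-trans (m≤m+n (length M) 1) short) (query false) (query true)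
    where
    open Resolvent res
    a b : Variable
    a = code (half false x)
    b = code (half true x)
    M : List Literal
    M = liftBy γ (literals R)
    uM : Unique (map var M)
    uM = liftBy-unique γ (literals R) (Clause.distinct R)
    x∉R : x ∉ map var (literals R)
    x∉R = resolvent-∌ (Clause.distinct C) (Clause.distinct D) res
    a∉M : a ∉ map var M
    a∉M a∈ = x∉R (half∈liftBy⁻ {γ} {false} (literals R) a∈)
    short : length M + 1 ≤ w
    short = begin
      length M + 1     ≡⟨ cong (_+ 1) (length-liftBy γ (literals R)) ⟩
      2 * width R + 1  ≤⟨ +-monoˡ-≤ 1 (*-monoʳ-≤ 2 R≤v) ⟩
      2 * v + 1        ≤⟨ 2v+1≤w ⟩
      w                ∎
      where open ≤-Reasoning
    lift-premise : ∀ {ls l} c → var l ≡ x → (∀ {m} → m ∈ ls → m ≡ l ⊎ m ∈ literals R) →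
      liftBy (γ [ x ≔ c ]) ls ⊆ falsify b (c xor refuting l) ∷ falsify a c ∷ M
    lift-premise {ls} {l} c refl sub {l̂} l̂∈ with ∈-liftBy⁻ {γ [ x ≔ c ]} ls l̂∈
    ... | m , m∈ , l̂∈h with sub m∈
    ...   | inj₁ refl = [ there ∘ here , here ]′ (∈-pair (subst (λ c → l̂ ∈ halves l c) (≔-same γ x c) l̂∈h))
      where
      ∈-pair : ∀ {p q : Literal} → l̂ ∈ p ∷ q ∷ [] → l̂ ≡ p ⊎ l̂ ≡ q
      ∈-pair (here e) = inj₁ e
      ∈-pair (there (here e)) = inj₂ e
    ...   | inj₂ m∈R = there (there (∈-liftBy⁺ {γ} m∈R
      (subst (λ c → l̂ ∈ halves m c) (≔-other γ c λ e → x∉R (subst (_∈ _) e (∈-map⁺ var m∈R))) l̂∈h)))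
    fromC : ∀ c → Derivable (falsify b (c xor false) ∷ falsify a c ∷ M)
    fromC c = derivable-⊆ (lift-premise {literals C} {pos x} c refl left) (liftC (γ [ x ≔ c ]))
    fromD : ∀ c → Derivable (falsify b (c xor true) ∷ falsify a c ∷ M)
    fromD c = derivable-⊆ (lift-premise {literals D} {neg x} c refl right) (liftD (γ [ x ≔ c ]))
    query : ∀ c → Derivable (falsify a c ∷ M)
    query c = derivable-branch {b} b∉ (a-fresh ∷ uM) (≤-trans (≤-reflexive (+-comm 1 (length M))) short)
      (proj₁ (premises c)) (proj₂ (premises c))
      where
      a-fresh : All (var (falsify a c) ≢_) (map var M)
      a-fresh = All.tabulate λ y∈ e → a∉M (subst (_∈ map var M) (trans (sym e) (var-falsify a c)) y∈)
      b∉ : b ∉ map var (falsify a c ∷ M)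
      b∉ (here e) with code-injective (half true x) (half false x) (trans e (var-falsify a c))
      ... | ()
      b∉ (there b∈) = x∉R (half∈liftBy⁻ {γ} {true} (literals R) b∈)
      -- The variable x is false exactly if the second half agrees with c, so the premises change
      -- places with c.
      premises : ∀ c → Derivable (pos b ∷ falsify a c ∷ M) × Derivable (neg b ∷ falsify a c ∷ M)
      premises false = fromC false , fromD false
      premises true  = fromD true , fromC true

  lift-derivation : ∀ {π} → Derivation E π → Narrow v π → All Liftable π
  lift-derivation [] [] = []
  lift-derivation (_∷_ {C} (axiom C∈) d) (C≤v ∷ n) with find C∈
  ... | A , A∈ , e = lift-axiom {A} {C} A∈ e C≤v ∷ lift-derivation d n
  lift-derivation (_∷_ {R} (resolve {C} {D} C∈ D∈ res) d) (R≤v ∷ n) with lift-derivation d n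
  ... | ih = lift-resolve {C} {D} {R} (proj₁ (Resolves⇒Resolvent {C} {D} {R} res))
               (proj₂ (Resolves⇒Resolvent {C} {D} {R} res)) R≤v (All.lookup ih C∈) (All.lookup ih D∈) ∷ ih

  lift-refutation : ∀ {π} → Refutes π E → W π ≤ v → NarrowRefutation F w
  lift-refutation {π} (d , C , _ , refl , e) W≤ =
    let k , Q , _ , y = derivable-⊆ nothing (All.head (lift-derivation d (W≤⇒Narrow π W≤)) (λ _ → false)) ∅
        ρ , ref , ρ≤w , _ = yields-[]⇒refutation {Q} y
    in ρ , ref , ρ≤w
    where
    nothing : liftBy (λ _ → false) (literals C) ⊆ []
    nothing l̂∈ with ∈-liftBy⁻ (literals C) l̂∈
    ... | l , l∈ , _ with Equivalence.to e l∈
    ...   | ()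

-- Assignments given by linear orders

does-true : ∀ {A : Set} (d : Dec A) → does d ≡ true → A
does-true (yes a) _ = a

does-false : ∀ {A : Set} (d : Dec A) → does d ≡ false → ¬ A
does-false (no ¬a) _ = ¬a

-- The critical assignments are given by a ranking of the elements with a single
-- element, the bottom, whose witness does not precede it.
record Order (m : ℕ) : Set where
  field
    rank witness : ℕ → ℕ
    bottom       : ℕ
    witness<     : ∀ {j} → j ≢ bottom → witness j < m
    descends     : ∀ {j} → j ≢ bottom → rank (witness j) < rank j

  holds : Var → Bool
  holds (prec i j)  = does (rank i <? rank j)
  holds (below j i) = does (witness j <? i)
  holds _           = true

open Order

natural : ∀ {m} → 0 < m → Order m
natural 0<m = record
  { rank = id ; witness = λ _ → 0 ; bottom = 0 ; witness< = λ _ → 0<m ; descends = n≢0⇒n>0 }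

elements : Var → List ℕ
elements (prec i j)  = i ∷ j ∷ []
elements (below j _) = j ∷ []
elements _           = []

length-elements : ∀ v → length (elements v) ≤ 2
length-elements (prec _ _)  = ≤-refl
length-elements (below _ _) = s≤s z≤n
length-elements (half _ _)  = z≤n
length-elements (pad _)     = z≤n

-- With f moved below all other elements, the old bottom receives f as its witness, and f becomes
-- the exception. Only variables that mention f or the old bottom can change their values.
module Sink {m} (o : Order m) (f : ℕ) (f<m : f < m) where

  rank′ : ℕ → ℕ
  rank′ i with i ≟ f
  ... | yes _ = 0
  ... | no _  = suc (rank o i)

  witness′ : ℕ → ℕ
  witness′ j with j ≟ bottom o
  ... | yes _ = f
  ... | no _  = witness o j

  rank′-other : ∀ {i} → i ≢ f → rank′ i ≡ suc (rank o i)
  rank′-other {i} i≢f with i ≟ f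
  ... | yes i≡f = contradiction i≡f i≢f
  ... | no _ = refl

  rank′-≤ : ∀ i → rank′ i ≤ suc (rank o i)
  rank′-≤ i with i ≟ f
  ... | yes _ = z≤n
  ... | no _ = ≤-refl

  rank′-f : rank′ f ≡ 0
  rank′-f with f ≟ f
  ... | yes _ = refl
  ... | no f≢f = contradiction refl f≢f

  witness′-other : ∀ {j} → j ≢ bottom o → witness′ j ≡ witness o j
  witness′-other {j} j≢ with j ≟ bottom o
  ... | yes j≡ = contradiction j≡ j≢
  ... | no _ = refl

  witness′< : ∀ {j} → j ≢ f → witness′ j < m
  witness′< {j} _ with j ≟ bottom o
  ... | yes _ = f<m
  ... | no j≢ = witness< o j≢

  descends′ : ∀ {j} → j ≢ f → rank′ (witness′ j) < rank′ j
  descends′ {j} j≢f rewrite rank′-other j≢f with j ≟ bottom o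
  ... | yes _ rewrite rank′-f = z<s
  ... | no j≢ = s≤s (≤-trans (rank′-≤ (witness o j)) (descends o j≢))

  sink : Order m
  sink = record
    { rank = rank′ ; witness = witness′ ; bottom = f ; witness< = witness′< ; descends = descends′ }

  holds-sink : ∀ v → bottom o ∉ elements v → f ∉ elements v → holds sink v ≡ holds o v
  holds-sink (prec i j) _ f∉
    rewrite rank′-other {i} (λ e → f∉ (here (sym e))) | rank′-other {j} (λ e → f∉ (there (here (sym e)))) = refl
  holds-sink (below j i) b∉ _ rewrite witness′-other {j} (λ e → b∉ (here (sym e))) = refl
  holds-sink (half _ _) _ _ = refl
  holds-sink (pad _) _ _ = refl

open Sink using (sink; holds-sink)

value-false : ∀ {α} l → value α l ≡ false → α (var l) ≡ refuting l
value-false (pos x) e = e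
value-false (neg x) e = not-injective e

refuting-false : ∀ {α} l → α (var l) ≡ refuting l → value α l ≡ false
refuting-false (pos x) e = e
refuting-false (neg x) e = cong not e

refuting-falsify : ∀ x b → refuting (falsify x b) ≡ b
refuting-falsify x false = refl
refuting-falsify x true  = refl

module _ {m} (o : Order m) (β : Var → Bool)
  (β-prec : ∀ i j → β (prec i j) ≡ holds o (prec i j)) (β-below : ∀ j i → β (below j i) ≡ holds o (below j i)) where

  Refuted : Literal → Set
  Refuted l = β (decode (var l)) ≡ refuting l × bottom o ∉ elements (decode (var l))

  private
    at : ∀ v {b} → β (decode (code v)) ≡ b × bottom o ∉ elements (decode (code v)) → β v ≡ b × bottom o ∉ elements v
    at v r rewrite decode-code v = r

    prec-true : ∀ i j → Refuted (x⁻ i j) → rank o i < rank o j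
    prec-true i j r = does-true (rank o i <? rank o j) (trans (sym (β-prec i j)) (proj₁ (at (prec i j) r)))

    prec-false : ∀ i j → Refuted (x⁺ i j) → ¬ rank o i < rank o j
    prec-false i j r = does-false (rank o i <? rank o j) (trans (sym (β-prec i j)) (proj₁ (at (prec i j) r)))

    below-true : ∀ j i → Refuted (y⁻ j i) → witness o j < i
    below-true j i r = does-true (witness o j <? i) (trans (sym (β-below j i)) (proj₁ (at (below j i) r)))

    below-false : ∀ j i → Refuted (y⁺ j i) → ¬ witness o j < i
    below-false j i r = does-false (witness o j <? i) (trans (sym (β-below j i)) (proj₁ (at (below j i) r)))

    not-bottom : ∀ j i → bottom o ∉ elements (decode (code (below j i))) → j ≢ bottom o
    not-bottom j i b∉ refl rewrite decode-code (below j i) = b∉ (here refl)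

  -- Avoiding the bottom matters in the last two axioms, which require that the witness of k is less
  -- than m and that it precedes k.
  axioms-hold : ∀ {i j k p} → p ∈ orderingAxioms m i j k → ¬ All Refuted p
  axioms-hold {k = k} (here refl) (r ∷ []) = <-irrefl refl (prec-true k k r)
  axioms-hold {i} {j} {k} (there (here refl)) (r ∷ s ∷ t ∷ []) =
    prec-false i j t (<-trans (prec-true i k r) (prec-true k j s))
  axioms-hold {k = k} (there (there (here refl))) (r ∷ []) = contradiction (below-true k 0 r) λ ()
  axioms-hold {k = k} (there (there (there (here refl)))) (r ∷ []) =
    below-false k m r (witness< o (not-bottom k m (proj₂ r)))
  axioms-hold {i} {j} {k} (there (there (there (there (here refl))))) (r ∷ s ∷ t ∷ []) =
    prec-false i k t (subst (λ w → rank o w < rank o k) witness≡i (descends o (not-bottom k i (proj₂ s))))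
    where
    witness≡i : witness o k ≡ i
    witness≡i = ≤-antisym (≤-pred (below-true k (suc i) r)) (≮⇒≥ (below-false k i s))

  ordering-holds : ∀ {p} → p ∈ ordering m → ¬ All Refuted p
  ordering-holds p∈ = let i , j , k , p∈ijk = ∈-ordering⁻ m p∈ in axioms-hold {i} {j} {k} p∈ijk

All-lifts⁻ : ∀ {P Q : Literal → Set} → (∀ l c → All P (halves l c) → Q l) →
  ∀ ls {p̂} → p̂ ∈ lifts ls → All P p̂ → All Q ls
All-lifts⁻ f [] _ _ = []
All-lifts⁻ f (l ∷ ls) p̂∈ all with find (∈-concatMap⁻ (λ c → map (halves l c ++_) (lifts ls)) {xs = false ∷ true ∷ []} p̂∈)
... | c , _ , p̂∈c with ∈-map⁻ (halves l c ++_) p̂∈c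
All-lifts⁻ f (l ∷ ls) _ (p ∷ q ∷ all) | c , _ , _ | q̂ , q̂∈ , refl =
  f l c (p ∷ q ∷ []) ∷ All-lifts⁻ f ls q̂∈ all

-- The combined formula

pads : ℕ → List (List Literal)
pads n = map (λ i → [ pos (code (pad i)) ]) (upTo n)

patterns : ℕ → ℕ → ℕ → List (List Literal)
patterns m t n = ordering m ++ concatMap lifts (ordering t) ++ pads n

formula : ℕ → ℕ → ℕ → CNF
formula m t n = toCNF (patterns m t n)

-- The common core of the lower bounds

elementsʰ : Var → List ℕ
elementsʰ (half _ x) = elements (decode x)
elementsʰ _          = []

length-elementsʰ : ∀ v → length (elementsʰ v) ≤ 2
length-elementsʰ (prec _ _)  = z≤n
length-elementsʰ (below _ _) = z≤n
length-elementsʰ (half _ x)  = length-elements (decode x)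
length-elementsʰ (pad _)     = z≤n

-- The restriction ρ gives the half proj₁ (ρ x) of x the value proj₂ (ρ x), and the
-- other half the value that makes the exclusive or equal to the value of x under G.
module LowerBound {m t n : ℕ} (ρ : Variable → Bool × Bool) where

  eval : Order t → Order m → Var → Bool
  eval G H (half c x) = proj₂ (ρ x) xor ((c xor proj₁ (ρ x)) ∧ holds G (decode x))
  eval G H (pad _)    = true
  eval G H v          = holds H v

  assignment : Order t → Order m → Assignment
  assignment G H = eval G H ∘ decode

  Falsifies : Order t → Order m → Clause → Set
  Falsifies G H C = All (λ l → value (assignment G H) l ≡ false) (literals C)

  eval-halves : ∀ G H x → eval G H (half false x) xor eval G H (half true x) ≡ holds G (decode x)
  eval-halves G H x with proj₂ (ρ x) | proj₁ (ρ x) | holds G (decode x)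
  ... | false | false | false = refl
  ... | false | false | true = refl
  ... | false | true | false = refl
  ... | false | true | true = refl
  ... | true | false | false = refl
  ... | true | false | true = refl
  ... | true | true | false = refl
  ... | true | true | true = refl

  Safe : Order t → Order m → Var → Set
  Safe G H v = bottom G ∉ elementsʰ v × bottom H ∉ elements v

  Critical : Order t → Order m → Literal → Set
  Critical G H l = value (assignment G H) l ≡ false × Safe G H (decode (var l))

  -- The property that is traced from the empty clause back towards the axioms, none of which has
  -- it.
  Reached : Clause → Set
  Reached C = ∃[ G ] ∃[ H ] All (Critical G H) (literals C)

  -- The exclusive or of the two falsified halves is the value of the original variable under G,
  -- whatever the restriction.
  critical-halves : ∀ G H l c → All (Critical G H) (halves l c) →
    holds G (decode (var l)) ≡ refuting l × bottom G ∉ elements (decode (var l))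
  critical-halves G H l c ((p , safe , _) ∷ (q , _) ∷ []) =
    (begin
      holds G (decode (var l))                               ≡⟨ eval-halves G H (var l) ⟨
      eval G H (half false (var l)) xor eval G H (half true (var l))
                                                             ≡⟨ cong₂ _xor_ (at false c p) (at true (c xor refuting l) q) ⟩
      c xor (c xor refuting l)                               ≡⟨ xor-assoc c c (refuting l) ⟨
      (c xor c) xor refuting l                               ≡⟨ cong (_xor refuting l) (xor-same c) ⟩
      refuting l                                             ∎)
    , subst (λ v → bottom G ∉ elementsʰ v) (trans (cong decode (var-falsify (code (half false (var l))) c)) (decode-code (half false (var l)))) safe
    where
    open ≡-Reasoning
    at : ∀ b c → value (assignment G H) (falsify (code (half b (var l))) c) ≡ false → eval G H (half b (var l)) ≡ c
    at b c e = begin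
      eval G H (half b (var l))  ≡⟨ cong (eval G H) (decode-code (half b (var l))) ⟨
      assignment G H x           ≡⟨ cong (assignment G H) (var-falsify x c) ⟨
      assignment G H (var (falsify x c))  ≡⟨ value-false (falsify x c) e ⟩
      refuting (falsify x c)     ≡⟨ refuting-falsify x c ⟩
      c                          ∎
      where
      x : Variable
      x = code (half b (var l))

  axioms-unreached : ∀ {A C} → A ∈ clauses (formula m t n) → C ≈ A → ¬ Reached C
  axioms-unreached {A} {C} A∈ e (G , H , crit) with
    All.tabulate {xs = literals A} (λ l∈ → All.lookup crit (Equivalence.from e l∈)) |
    ∈-++⁻ (ordering m) (∈-toCNF⁻ (patterns m t n) A∈)
  ... | critA | inj₁ p∈ = ordering-holds H (eval G H) (λ _ _ → refl) (λ _ _ → refl) p∈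
        (All.map (λ {l} (v , _ , b∉) → value-false l v , b∉) critA)
  ... | critA | inj₂ p∈ with ∈-++⁻ (concatMap lifts (ordering t)) p∈
  ...   | inj₁ p̂∈ with find (∈-concatMap⁻ lifts {xs = ordering t} p̂∈)
  ...     | p , p∈t , p̂∈p = ordering-holds G (holds G) (λ _ _ → refl) (λ _ _ → refl) p∈t
              (All-lifts⁻ (critical-halves G H) p p̂∈p critA)
  axioms-unreached {A} {C} A∈ e (G , H , crit) | critA | inj₂ p∈ | inj₂ pad∈
    with ∈-map⁻ (λ i → [ pos (code (pad i)) ]) pad∈
  ... | i , _ , eq with subst (All (Critical G H)) eq critA
  ...   | (v , _) ∷ [] with trans (sym v) (cong (eval G H) (decode-code (pad i)))
  ...     | ()

  -- A variable mentions at most two elements, so the `+ 2` leaves an element that is fresh for the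
  -- clause and for the variable resolved upon. Any list that covers the elements is allowed, so the
  -- hard ones can be counted through exclusive ors.
  record Bounded (C : Clause) : Set where
    field
      hard easy : List ℕ
      hard<     : length hard + 2 < t
      easy<     : length easy + 2 < m
      hard⊇     : ∀ {l} → l ∈ literals C → elementsʰ (decode (var l)) ⊆ hard
      easy⊇     : ∀ {l} → l ∈ literals C → elements (decode (var l)) ⊆ easy

  eval-sink : ∀ G H {f g} f<t g<m v → Safe G H v → f ∉ elementsʰ v → g ∉ elements v →
    eval (sink G f f<t) (sink H g g<m) v ≡ eval G H v
  eval-sink G H f<t g<m (half c x) (b∉ , _) f∉ _ =
    cong (λ h → proj₂ (ρ x) xor ((c xor proj₁ (ρ x)) ∧ h)) (holds-sink G _ f<t (decode x) b∉ f∉)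
  eval-sink G H f<t g<m (pad _) _ _ _ = refl
  eval-sink G H f<t g<m v@(prec _ _) (_ , b∉) _ g∉ = holds-sink H _ g<m v b∉ g∉
  eval-sink G H f<t g<m v@(below _ _) (_ , b∉) _ g∉ = holds-sink H _ g<m v b∉ g∉

  -- Before x is resolved upon, fresh elements that neither R nor x mentions are sunk to the bottom.
  premise-reached : ∀ {D E R x} → Resolvent x (literals D) (literals E) (literals R) →
    (∀ {G H} → Falsifies G H R → Bounded R) → Reached R → Reached D ⊎ Reached E
  premise-reached {D} {E} {R} {x} res bounded (G , H , crit) =
    [ (λ e → inj₁ (G′ , H′ , All.tabulate λ l∈ → premise {m = pos x} refl (left l∈) e))
    , (λ e → inj₂ (G′ , H′ , All.tabulate λ l∈ → premise {m = neg x} refl (right l∈) (cong not e))) ]′ (bool (assignment G′ H′ x))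
    where
    open Resolvent res
    open Bounded (bounded (All.map proj₁ crit))
    bool : ∀ b → b ≡ false ⊎ b ≡ true
    bool false = inj₁ refl
    bool true  = inj₂ refl
    v : Var
    v = decode x
    fresh-for : ∀ {k} ys zs → length ys + 2 < k → length zs ≤ 2 → ∃[ f ] (f < k × f ∉ ys ++ zs)
    fresh-for ys zs ys< zs≤ = fresh (ys ++ zs)
      (≤-<-trans (≤-trans (≤-reflexive (length-++ ys)) (+-monoʳ-≤ (length ys) zs≤)) ys<)
    G-fresh : ∃[ f ] (f < t × f ∉ hard ++ elementsʰ v)
    G-fresh = fresh-for hard (elementsʰ v) hard< (length-elementsʰ v)
    H-fresh : ∃[ f ] (f < m × f ∉ easy ++ elements v)
    H-fresh = fresh-for easy (elements v) easy< (length-elements v)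
    G′ : Order t
    G′ = sink G (proj₁ G-fresh) (proj₁ (proj₂ G-fresh))
    H′ : Order m
    H′ = sink H (proj₁ H-fresh) (proj₁ (proj₂ H-fresh))
    safe-x : Safe G′ H′ v
    safe-x = proj₂ (proj₂ G-fresh) ∘ ∈-++⁺ʳ hard , proj₂ (proj₂ H-fresh) ∘ ∈-++⁺ʳ easy
    safe-R : ∀ {l} → l ∈ literals R → Safe G′ H′ (decode (var l))
    safe-R l∈ = proj₂ (proj₂ G-fresh) ∘ ∈-++⁺ˡ ∘ hard⊇ l∈ , proj₂ (proj₂ H-fresh) ∘ ∈-++⁺ˡ ∘ easy⊇ l∈
    crit′ : ∀ {l} → l ∈ literals R → Critical G′ H′ l
    crit′ {l} l∈ = refuting-false l (trans
        (eval-sink G H _ _ (decode (var l)) (proj₂ (All.lookup crit l∈)) (proj₁ (safe-R l∈)) (proj₂ (safe-R l∈)))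
        (value-false l (proj₁ (All.lookup crit l∈))))
      , safe-R l∈
    premise : ∀ {l m} → var m ≡ x → l ≡ m ⊎ l ∈ literals R → value (assignment G′ H′) m ≡ false → Critical G′ H′ l
    premise refl (inj₁ refl) e = e , safe-x
    premise _ (inj₂ l∈R) _ = crit′ l∈R

  unreached : ∀ {π} → Derivation (formula m t n) π →
    (∀ {C} → C ∈ π → ∀ {G H} → Falsifies G H C → Bounded C) → All (¬_ ∘ Reached) π
  unreached [] _ = []
  unreached (_∷_ {C} (axiom C∈) d) bounded with find C∈
  ... | A , A∈ , e = axioms-unreached {A} {C} A∈ e ∷ unreached d (bounded ∘ there)
  unreached (_∷_ {R} (resolve {D} {E} D∈ E∈ res) d) bounded =
    ([ All.lookup ih D∈ , All.lookup ih E∈ ]′ ∘ premise-reached {D} {E} {R} resolvent (bounded (here refl))) ∷ ih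
    where
    resolvent = proj₂ (Resolves⇒Resolvent {D} {E} {R} res)
    ih = unreached d (bounded ∘ there)

  -- The empty clause is vacuously reached. Asking for bounds only on clauses that are falsified is
  -- what lets a restriction dispose of wide clauses by satisfying them.
  no-refutation : 0 < t → 0 < m → ∀ {π} → Refutes π (formula m t n) →
    ¬ (∀ {C} → C ∈ π → ∀ {G H} → Falsifies G H C → Bounded C)
  no-refutation 0<t 0<m (d , C , _ , refl , C≈𝟘) bounded =
    All.head (unreached d bounded)
      (natural 0<t , natural 0<m , All.tabulate λ l∈ → contradiction (Equivalence.to C≈𝟘 l∈) λ ())

-- Choosing a restriction

total : ∀ {X : Set} → (X → ℕ) → List X → ℕ
total f = foldr (λ x → f x +_) 0

total-bound : ∀ {X : Set} {f : X → ℕ} {b} xs → (∀ {x} → x ∈ xs → f x ≤ b) → total f xs ≤ length xs * b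
total-bound [] _ = z≤n
total-bound (x ∷ xs) h = +-mono-≤ (h (here refl)) (total-bound xs (h ∘ there))

total-*ʳ : ∀ {X : Set} (f : X → ℕ) k xs → total f xs * k ≡ total (λ x → f x * k) xs
total-*ʳ f k [] = refl
total-*ʳ f k (x ∷ xs) = trans (*-distribʳ-+ k (f x) (total f xs)) (cong (f x * k +_) (total-*ʳ f k xs))

Option : Set
Option = Bool × Bool

-- Conditional expectations: the weight of C bounds 4 ^ length xs times the probability that
-- random options for xs do not kill C, since at least one option for a touched variable does.
module Killing {X : Set} (Kills : Option → Variable → X → Set) (kills? : ∀ o x C → Dec (Kills o x C))
  (Touches : Variable → X → Set) (touches? : ∀ C x → Dec (Touches x C))
  (kill : ∀ {x C} → Touches x C → ∃[ o ] Kills o x C) where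

  factor : Variable → X → ℕ
  factor x C with touches? C x
  ... | yes _ = 3
  ... | no _  = 4

  weight : List Variable → X → ℕ
  weight [] C = 1
  weight (x ∷ xs) C = factor x C * weight xs C

  survivors : Option → Variable → List X → List X
  survivors o x = filter (λ C → ¬? (kills? o x C))

  contribution : Option → Variable → ℕ → X → ℕ
  contribution o x w C with kills? o x C
  ... | yes _ = 0
  ... | no _  = w

  contribution-≤ : ∀ o x w C → contribution o x w C ≤ w
  contribution-≤ o x w C with kills? o x C
  ... | yes _ = z≤n
  ... | no _ = ≤-refl

  contribution-kills : ∀ o x w C → Kills o x C → contribution o x w C ≡ 0
  contribution-kills o x w C k with kills? o x C
  ... | yes _ = refl
  ... | no ¬k = contradiction k ¬k

  total-survivors : ∀ f o x C Cs →
    total f (survivors o x (C ∷ Cs)) ≡ contribution o x (f C) C + total f (survivors o x Cs)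
  total-survivors f o x C Cs with kills? o x C
  ... | yes _ = refl
  ... | no _ = refl

  Σ-options : (Option → ℕ) → ℕ
  Σ-options g = (g (false , false) + g (false , true)) + (g (true , false) + g (true , true))

  Σ-options-+ : ∀ g h → Σ-options (λ o → g o + h o) ≡ Σ-options g + Σ-options h
  Σ-options-+ g h = interchange (g _) (h _) (g _) (h _) (g _) (h _) (g _) (h _)
    where
    interchange : ∀ a b c d e f i j →
      ((a + b) + (c + d)) + ((e + f) + (i + j)) ≡ ((a + c) + (e + i)) + ((b + d) + (f + j))
    interchange = solve-∀

  Σ-options-pick : ∀ g {k} → Σ-options g < 4 * k → ∃[ o ] g o < k
  Σ-options-pick g {k} Σ< with g (false , false) <? k | g (false , true) <? k | g (true , false) <? k | g (true , true) <? k
  ... | yes p | _ | _ | _ = _ , p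
  ... | no _ | yes p | _ | _ = _ , p
  ... | no _ | no _ | yes p | _ = _ , p
  ... | no _ | no _ | no _ | yes p = _ , p
  ... | no p | no q | no r | no s = contradiction Σ< (≤⇒≯ (≤-trans (≤-reflexive (four k))
          (+-mono-≤ (+-mono-≤ (≮⇒≥ p) (≮⇒≥ q)) (+-mono-≤ (≮⇒≥ r) (≮⇒≥ s)))))
    where
    four : ∀ k → 4 * k ≡ (k + k) + (k + k)
    four = solve-∀

  Σ-options-≤ : ∀ g w → (∀ o → g o ≤ w) → Σ-options g ≤ 4 * w
  Σ-options-≤ g w g≤ = ≤-trans (+-mono-≤ (+-mono-≤ (g≤ _) (g≤ _)) (+-mono-≤ (g≤ _) (g≤ _))) (≤-reflexive (four w))
    where
    four : ∀ k → (k + k) + (k + k) ≡ 4 * k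
    four = solve-∀

  Σ-options-<4 : ∀ g w → (∀ o → g o ≤ w) → ∀ o → g o ≡ 0 → Σ-options g ≤ 3 * w
  Σ-options-<4 g w g≤ (false , false) e rewrite e = ≤-trans (+-mono-≤ (g≤ _) (+-mono-≤ (g≤ _) (g≤ _))) (≤-reflexive (three w))
    where
    three : ∀ k → k + (k + k) ≡ 3 * k
    three = solve-∀
  Σ-options-<4 g w g≤ (false , true) e rewrite e = ≤-trans (+-mono-≤ (+-mono-≤ (g≤ _) z≤n) (+-mono-≤ (g≤ _) (g≤ _))) (≤-reflexive (three w))
    where
    three : ∀ k → (k + 0) + (k + k) ≡ 3 * k
    three = solve-∀
  Σ-options-<4 g w g≤ (true , false) e rewrite e = ≤-trans (+-mono-≤ (+-mono-≤ (g≤ _) (g≤ _)) (g≤ _)) (≤-reflexive (three w))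
    where
    three : ∀ k → (k + k) + k ≡ 3 * k
    three = solve-∀
  Σ-options-<4 g w g≤ (true , true) e rewrite e = ≤-trans (+-mono-≤ (+-mono-≤ (g≤ _) (g≤ _)) (+-mono-≤ (g≤ _) z≤n)) (≤-reflexive (three w))
    where
    three : ∀ k → (k + k) + (k + 0) ≡ 3 * k
    three = solve-∀

  -- Four times the expectation over the options. A touched clause drops out under the option that
  -- kills it, so at most three copies of its weight remain.
  average : ∀ f x Cs → Σ-options (λ o → total f (survivors o x Cs)) ≤ total (λ C → factor x C * f C) Cs
  average f x [] = z≤n
  average f x (C ∷ Cs) = begin
    Σ-options (λ o → total f (survivors o x (C ∷ Cs)))
      ≡⟨ cong₂ _+_ (cong₂ _+_ (split _) (split _)) (cong₂ _+_ (split _) (split _)) ⟩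
    Σ-options (λ o → contribution o x (f C) C + total f (survivors o x Cs))
      ≡⟨ Σ-options-+ (λ o → contribution o x (f C) C) (λ o → total f (survivors o x Cs)) ⟩
    Σ-options (λ o → contribution o x (f C) C) + Σ-options (λ o → total f (survivors o x Cs))
      ≤⟨ +-mono-≤ one (average f x Cs) ⟩
    factor x C * f C + total (λ C → factor x C * f C) Cs
      ∎
    where
    open ≤-Reasoning
    split : ∀ o → _
    split o = total-survivors f o x C Cs
    one : Σ-options (λ o → contribution o x (f C) C) ≤ factor x C * f C
    one with touches? C x
    ... | yes t = let o , k = kill t in
          Σ-options-<4 _ (f C) (λ o → contribution-≤ o x (f C) C) o (contribution-kills o x (f C) C k)
    ... | no _ = Σ-options-≤ _ (f C) (λ o → contribution-≤ o x (f C) C)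

  -- Each option is chosen so that the surviving weight stays below the power of 4 for the variables
  -- still to come. At the end each survivor weighs 1 and the total is below 1, so there is none.
  kill-all : ∀ {xs} → Unique xs → ∀ Cs → total (weight xs) Cs < 4 ^ length xs →
    Σ[ ρ ∈ (Variable → Option) ] (∀ {C} → C ∈ Cs → ∃[ x ] (x ∈ xs × Kills (ρ x) x C))
  kill-all [] [] _ = (λ _ → false , false) , λ ()
  kill-all [] (_ ∷ _) (s≤s ())
  kill-all {x ∷ xs} (x∉ ∷ u) Cs light
    with Σ-options-pick (λ o → total (weight xs) (survivors o x Cs)) (≤-<-trans (average (weight xs) x Cs) light)
  ... | o , light′ with kill-all u (survivors o x Cs) light′
  ... | ρ , kills = ρ′ , kills′
    where
    ρ′ : Variable → Option
    ρ′ y with y ≟ x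
    ... | yes _ = o
    ... | no _  = ρ y
    ρ′-same : ρ′ x ≡ o
    ρ′-same with x ≟ x
    ... | yes _ = refl
    ... | no x≢x = contradiction refl x≢x
    ρ′-other : ∀ {y} → y ∈ xs → ρ′ y ≡ ρ y
    ρ′-other {y} y∈ with y ≟ x
    ... | yes refl = contradiction refl (All.lookup x∉ y∈)
    ... | no _ = refl
    kills′ : ∀ {C} → C ∈ Cs → ∃[ y ] (y ∈ x ∷ xs × Kills (ρ′ y) y C)
    kills′ {C} C∈ with kills? o x C
    ... | yes k = x , here refl , subst (λ o → Kills o x C) (sym ρ′-same) k
    ... | no ¬k = let y , y∈ , k = kills (∈-filter⁺ (λ C → ¬? (kills? o x C)) C∈ ¬k)
                  in y , there y∈ , subst (λ o → Kills o y C) (sym (ρ′-other y∈)) k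

  touched : List Variable → X → List Variable
  touched xs C = filter (touches? C) xs

  -- The bound `3 ^ T * 4 ^ (length xs ∸ T)`, multiplied by `4 ^ T` to avoid subtraction; touched
  -- variables in excess of T are counted with factor 4.
  weight-bound : ∀ T xs C → T ≤ length (touched xs C) → weight xs C * 4 ^ T ≤ 3 ^ T * 4 ^ length xs
  weight-bound zero [] C _ = ≤-refl
  weight-bound T (x ∷ xs) C T≤ with touches? C x
  ... | no _ = begin
    4 * weight xs C * 4 ^ T      ≡⟨ *-assoc 4 (weight xs C) (4 ^ T) ⟩
    4 * (weight xs C * 4 ^ T)    ≤⟨ *-monoʳ-≤ 4 (weight-bound T xs C T≤) ⟩
    4 * (3 ^ T * 4 ^ length xs)  ≡⟨ swap 4 (3 ^ T) (4 ^ length xs) ⟩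
    3 ^ T * (4 * 4 ^ length xs)  ∎
    where
    open ≤-Reasoning
    swap : ∀ a b c → a * (b * c) ≡ b * (a * c)
    swap = solve-∀
  weight-bound zero (x ∷ xs) C _ | yes _ = begin
    3 * weight xs C * 1          ≡⟨ *-assoc 3 (weight xs C) 1 ⟩
    3 * (weight xs C * 1)        ≤⟨ *-mono-≤ (n≤1+n 3) (weight-bound zero xs C z≤n) ⟩
    4 * (1 * 4 ^ length xs)      ≡⟨ swap 4 1 (4 ^ length xs) ⟩
    1 * (4 * 4 ^ length xs)      ∎
    where
    open ≤-Reasoning
    swap : ∀ a b c → a * (b * c) ≡ b * (a * c)
    swap = solve-∀
  weight-bound (suc T) (x ∷ xs) C (s≤s T≤) | yes _ = begin
    3 * weight xs C * (4 * 4 ^ T)        ≡⟨ regroup 3 (weight xs C) 4 (4 ^ T) ⟩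
    3 * 4 * (weight xs C * 4 ^ T)        ≤⟨ *-monoʳ-≤ (3 * 4) (weight-bound T xs C T≤) ⟩
    3 * 4 * (3 ^ T * 4 ^ length xs)      ≡⟨ regroup 3 (3 ^ T) 4 (4 ^ length xs) ⟨
    3 * 3 ^ T * (4 * 4 ^ length xs)      ∎
    where
    open ≤-Reasoning
    regroup : ∀ a b c d → a * b * (c * d) ≡ a * c * (b * d)
    regroup = solve-∀

  -- Union bound over fewer than (4/3)^T clauses.
  restriction : ∀ {xs} T Cs → Unique xs → (∀ {C} → C ∈ Cs → T ≤ length (touched xs C)) → length Cs * 3 ^ T < 4 ^ T →
    Σ[ ρ ∈ (Variable → Option) ] (∀ {C} → C ∈ Cs → ∃[ x ] (x ∈ xs × Kills (ρ x) x C))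
  restriction {xs} T Cs u wide few = kill-all u Cs (*-cancelʳ-< (4 ^ T) _ _ (begin-strict
    total (weight xs) Cs * 4 ^ T                ≡⟨ total-*ʳ (weight xs) (4 ^ T) Cs ⟩
    total (λ C → weight xs C * 4 ^ T) Cs        ≤⟨ total-bound Cs (λ {C} C∈ → weight-bound T xs C (wide C∈)) ⟩
    length Cs * (3 ^ T * 4 ^ length xs)         ≡⟨ *-assoc (length Cs) (3 ^ T) (4 ^ length xs) ⟨
    length Cs * 3 ^ T * 4 ^ length xs           <⟨ *-monoˡ-< (4 ^ length xs) {{m^n≢0 4 (length xs)}} few ⟩
    4 ^ T * 4 ^ length xs                       ≡⟨ *-comm (4 ^ T) (4 ^ length xs) ⟩
    4 ^ length xs * 4 ^ T                       ∎))
    where open ≤-Reasoning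

-- Lower bounds on width and length

^-distribʳ-* : ∀ n a b → (a * b) ^ n ≡ a ^ n * b ^ n
^-distribʳ-* zero a b = refl
^-distribʳ-* (suc n) a b = trans (cong (a * b *_) (^-distribʳ-* n a b)) (regroup a b (a ^ n) (b ^ n))
  where
  regroup : ∀ a b c d → a * b * (c * d) ≡ a * c * (b * d)
  regroup = solve-∀

infix 4 _≟ᵛ_
_≟ᵛ_ : DecidableEquality Var
v ≟ᵛ w = map′ (code-injective v w) (cong code) (code v ≟ code w)

-- A block is one exclusive or, named by the variable that it replaces.
blocks : Var → List Variable
blocks (half _ x) = x ∷ []
blocks _          = []

clauseBlocks : Clause → List Variable
clauseBlocks C = concatMap (blocks ∘ decode ∘ var) (literals C)

block-∈⁻ : ∀ v {x} → x ∈ blocks v → ∃[ b ] (v ≡ half b x)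
block-∈⁻ (half b _) (here refl) = b , refl

clauseBlocks-∈⁺ : ∀ {C l x} → l ∈ literals C → x ∈ blocks (decode (var l)) → x ∈ clauseBlocks C
clauseBlocks-∈⁺ l∈ x∈ = ∈-concatMap⁺ (blocks ∘ decode ∘ var) (lose l∈ x∈)

elementsʰ-block : ∀ v {e} → e ∈ elementsʰ v → ∃[ x ] (x ∈ blocks v × e ∈ elements (decode x))
elementsʰ-block (half _ x) e∈ = x , here refl , e∈

-- `refuting l` is the value that makes l false, so a fixed half with a different value c makes l
-- true.
Satisfies : Option → Variable → Clause → Set
Satisfies (b , c) x C = Any (λ l → decode (var l) ≡ half b x × refuting l ≢ c) (literals C)

satisfies? : ∀ o x C → Dec (Satisfies o x C)
satisfies? (b , c) x C = any? (λ l → (decode (var l) ≟ᵛ half b x) ×-dec ¬? (refuting l ≟ᵇ c)) (literals C)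

satisfy : ∀ {x C} → x ∈ clauseBlocks C → ∃[ o ] Satisfies o x C
satisfy {x} {C} x∈ with find (∈-concatMap⁻ (blocks ∘ decode ∘ var) {xs = literals C} x∈)
... | l , l∈ , x∈l with block-∈⁻ (decode (var l)) x∈l
... | b , e = (b , not (refuting l)) , lose l∈ (e , not-¬ refl)

length-concatMap-≤ : ∀ {A B : Set} {f : A → List B} {k} xs → (∀ {x} → x ∈ xs → length (f x) ≤ k) →
  length (concatMap f xs) ≤ k * length xs
length-concatMap-≤ [] _ = z≤n
length-concatMap-≤ {f = f} {k} (x ∷ xs) f≤ = begin
  length (f x ++ concatMap f xs)         ≡⟨ length-++ (f x) ⟩
  length (f x) + length (concatMap f xs) ≤⟨ +-mono-≤ (f≤ (here refl)) (length-concatMap-≤ xs (f≤ ∘ there)) ⟩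
  k + k * length xs                      ≡⟨ *-suc k (length xs) ⟨
  k * suc (length xs)                    ∎
  where open ≤-Reasoning

clauseElements : Clause → List ℕ
clauseElements C = concatMap (elements ∘ decode ∘ var) (literals C)

length-clauseElements : ∀ {w k C} π → C ∈ π → W π ≤ w → 2 * w + 2 < k → length (clauseElements C) + 2 < k
length-clauseElements {w} {C = C} π C∈ W≤ = ≤-<-trans (+-monoˡ-≤ 2 (≤-trans
  (length-concatMap-≤ (literals C) (λ {l} _ → length-elements (decode (var l))))
  (*-monoʳ-≤ 2 (All.lookup (W≤⇒Narrow π W≤) C∈))))

width-bound : ∀ {m t n w π} → 2 * w + 2 < t → 2 * w + 2 < m → Refutes π (formula m t n) → ¬ W π ≤ w
width-bound {m} {t} {n} {w} {π} <t <m ref W≤ = no-refutation (m<n⇒0<n <t) (m<n⇒0<n <m) ref λ {C} C∈ _ → record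
  { hard = concatMap (elementsʰ ∘ decode ∘ var) (literals C)
  ; easy = clauseElements C
  ; hard< = ≤-<-trans (+-monoˡ-≤ 2 (≤-trans
      (length-concatMap-≤ (literals C) (λ {l} _ → length-elementsʰ (decode (var l))))
      (*-monoʳ-≤ 2 (All.lookup (W≤⇒Narrow π W≤) C∈)))) <t
  ; easy< = length-clauseElements π C∈ W≤ <m
  ; hard⊇ = λ l∈ e∈ → ∈-concatMap⁺ (elementsʰ ∘ decode ∘ var) (lose l∈ e∈)
  ; easy⊇ = λ l∈ e∈ → ∈-concatMap⁺ (elements ∘ decode ∘ var) (lose l∈ e∈)
  }
  where open LowerBound {m} {t} {n} (λ _ → false , false)

falsified⇒unsatisfied : ∀ {m t n} ρ {G H C} → LowerBound.Falsifies {m} {t} {n} ρ G H C → ∀ x → ¬ Satisfies (ρ x) x C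
falsified⇒unsatisfied {m} {t} {n} ρ {G} {H} falsified x sat with find sat
... | l , l∈ , e , ≢ = ≢ (begin
  refuting l                                              ≡⟨ value-false l (All.lookup falsified l∈) ⟨
  LowerBound.eval {m} {t} {n} ρ G H (decode (var l))                  ≡⟨ cong (LowerBound.eval {m} {t} {n} ρ G H) e ⟩
  c xor ((b xor b) ∧ truth)                               ≡⟨ cong (λ d → c xor (d ∧ truth)) (xor-same b) ⟩
  c xor false                                        ≡⟨ xor-identityʳ c ⟩
  c                                                       ∎)
  where
  open ≡-Reasoning
  b c truth : Bool
  b = proj₁ (ρ x)
  c = proj₂ (ρ x)
  truth = Order.holds G (decode x)

-- With fewer than `2 ^ h` clauses, one restriction satisfies all those on at least `3 * h` blocks.
-- A falsified clause then has at most `2 * (3 * h)` hard elements and, by its width, at most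
-- `2 * w` easy ones, against `no-refutation`.
length-bound : ∀ {m t n w h π} → 2 * w + 2 < m → 2 * (3 * h) + 2 < t → Refutes π (formula m t n) → W π ≤ w → 2 ^ h ≤ L π
length-bound {m} {t} {n} {w} {h} {π} <m <t ref W≤ with 2 ^ h ≤? L π
... | yes 2^h≤ = 2^h≤
... | no 2^h≰ = ⊥-elim (no-refutation (m<n⇒0<n <t) (m<n⇒0<n <m) ref λ {C} C∈ {G} {H} falsified → record
  { hard = concatMap (elements ∘ decode) (touched xs C)
  ; easy = clauseElements C
  ; hard< = ≤-<-trans (+-monoˡ-≤ 2 (≤-trans
      (length-concatMap-≤ (touched xs C) (λ {x} _ → length-elements (decode x)))
      (*-monoʳ-≤ 2 (<⇒≤ (≰⇒> λ wide →
        let x , _ , sat = kills (∈-filter⁺ wide? C∈ wide) in falsified⇒unsatisfied {m} {t} {n} ρ {G} {H} {C} falsified x sat))))) <t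
  ; easy< = length-clauseElements π C∈ W≤ <m
  ; hard⊇ = λ {l} l∈ e∈ →
      let x , x∈ , e∈x = elementsʰ-block (decode (var l)) e∈
          x∈C = clauseBlocks-∈⁺ {C} l∈ x∈
      in ∈-concatMap⁺ (elements ∘ decode) (lose (∈-filter⁺ (_∈ⁿ? clauseBlocks C)
           (∈-deduplicate⁺ _≟_ (∈-concatMap⁺ clauseBlocks (lose C∈ x∈C))) x∈C) e∈x)
  ; easy⊇ = λ l∈ e∈ → ∈-concatMap⁺ (elements ∘ decode ∘ var) (lose l∈ e∈)
  })
  where
  open DecMembership _≟_ using () renaming (_∈?_ to _∈ⁿ?_)
  open Killing Satisfies satisfies? (λ x C → x ∈ clauseBlocks C) (λ C x → x ∈ⁿ? clauseBlocks C) (λ {x} {C} → satisfy {x} {C})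
  xs : List Variable
  xs = deduplicate _≟_ (concatMap clauseBlocks π)
  wide? : ∀ C → Dec (3 * h ≤ length (touched xs C))
  wide? C = 3 * h ≤? length (touched xs C)
  -- Three blocks pay for one factor 2, since 2 * 3 ^ 3 = 54 is at most 4 ^ 3 = 64.
  few : length (filter wide? π) * 3 ^ (3 * h) < 4 ^ (3 * h)
  few = begin-strict
    length (filter wide? π) * 3 ^ (3 * h)  ≤⟨ *-monoˡ-≤ (3 ^ (3 * h)) (length-filter wide? π) ⟩
    length π * 3 ^ (3 * h)                 <⟨ *-monoˡ-< (3 ^ (3 * h)) {{m^n≢0 3 (3 * h)}} (≰⇒> 2^h≰) ⟩
    2 ^ h * 3 ^ (3 * h)                    ≡⟨ cong (2 ^ h *_) (^-*-assoc 3 3 h) ⟨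
    2 ^ h * 27 ^ h                         ≡⟨ ^-distribʳ-* h 2 27 ⟨
    54 ^ h                                 ≤⟨ ^-monoˡ-≤ h (m≤m+n 54 10) ⟩
    64 ^ h                                 ≡⟨ ^-*-assoc 4 3 h ⟩
    4 ^ (3 * h)                            ∎
    where open ≤-Reasoning
  killing : Σ[ ρ ∈ (Variable → Option) ] (∀ {C} → C ∈ filter wide? π → ∃[ x ] (x ∈ xs × Satisfies (ρ x) x C))
  killing = restriction (3 * h) (filter wide? π) (deduplicate-! _≟_ (concatMap clauseBlocks π))
    (λ {C} C∈ → proj₂ (∈-filter⁻ wide? {xs = π} C∈)) few
  ρ : Variable → Option
  ρ = proj₁ killing
  kills : ∀ {C} → C ∈ filter wide? π → ∃[ x ] (x ∈ xs × Satisfies (ρ x) x C)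
  kills = proj₂ killing
  open LowerBound {m} {t} {n} ρ

-- Soundness of resolution; unsatisfiability thus follows from the refutations constructed above.
refutable⇒unsatisfiable : ∀ {F π} → Refutes π F → Unsatisfiable F
refutable⇒unsatisfiable {F} (d , C , _ , refl , C≈𝟘) α α⊨F =
  let l , l∈ , _ = find (All.head trues)
  in contradiction (Equivalence.to C≈𝟘 l∈) λ ()
  where
  True : Clause → Set
  True C = Any (λ l → value α l ≡ true) (literals C)
  axiom-true : ∀ {C A} → A ∈ clauses F → C ≈ A → True C
  axiom-true A∈ e = let l , l∈ , t = find (All.lookup α⊨F A∈) in lose (Equivalence.from e l∈) t
  resolve-true : ∀ {D E R} → Resolves D E R → True D → True E → True R
  resolve-true {D} {E} {R} res D-true E-true with Resolves⇒Resolvent {D} {E} {R} res | find D-true | find E-true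
  ... | x , r | l , l∈ , lt | m , m∈ , mt with Resolvent.left r l∈ | Resolvent.right r m∈
  ...   | inj₂ l∈R | _ = lose l∈R lt
  ...   | inj₁ _ | inj₂ m∈R = lose m∈R mt
  ...   | inj₁ refl | inj₁ refl = contradiction (trans (sym mt) (cong not lt)) λ ()
  trues = Derivation-preserves True
    (λ {C} {A} → axiom-true {C} {A}) (λ {D} {E} {R} → resolve-true {D} {E} {R}) d

-- Size of the formula

length-orderingAxiom : ∀ {m i j k p} → p ∈ orderingAxioms m i j k → length p ≤ 3
length-orderingAxiom (here refl) = s≤s z≤n
length-orderingAxiom (there (here refl)) = ≤-refl
length-orderingAxiom (there (there (here refl))) = s≤s z≤n
length-orderingAxiom (there (there (there (here refl)))) = s≤s z≤n
length-orderingAxiom (there (there (there (there (here refl))))) = ≤-refl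

length-∈-ordering : ∀ m {p} → p ∈ ordering m → length p ≤ 3
length-∈-ordering m {p} p∈ = let i , j , k , p∈ijk = ∈-ordering⁻ m {p} p∈ in length-orderingAxiom {m} {i} {j} {k} p∈ijk

length-ordering : ∀ m → length (ordering m) ≤ 5 * m * m * m
length-ordering m = begin
  length (ordering m)                  ≤⟨ length-concatMap-≤ (upTo m) (λ _ → length-concatMap-≤ (upTo m) (λ _ → length-concatMap-≤ (upTo m) (λ _ → ≤-refl))) ⟩
  5 * length (upTo m) * length (upTo m) * length (upTo m)
                                       ≡⟨ cong (λ k → 5 * k * k * k) (length-upTo m) ⟩
  5 * m * m * m                        ∎
  where open ≤-Reasoning

length-∈-lifts : ∀ ls {p̂} → p̂ ∈ lifts ls → length p̂ ≡ 2 * length ls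
length-∈-lifts [] (here refl) = refl
length-∈-lifts (l ∷ ls) p̂∈ with find (∈-concatMap⁻ (λ c → map (halves l c ++_) (lifts ls)) {xs = false ∷ true ∷ []} p̂∈)
... | c , _ , p̂∈c with ∈-map⁻ (halves l c ++_) p̂∈c
... | q̂ , q̂∈ , refl = trans (cong (2 +_) (length-∈-lifts ls q̂∈)) (sym (*-suc 2 (length ls)))

length-lifts : ∀ ls → length (lifts ls) ≡ 2 ^ length ls
length-lifts [] = refl
length-lifts (l ∷ ls) = begin
  length (map (halves l false ++_) (lifts ls) ++ map (halves l true ++_) (lifts ls) ++ [])
    ≡⟨ length-++ (map (halves l false ++_) (lifts ls)) ⟩
  length (map (halves l false ++_) (lifts ls)) + length (map (halves l true ++_) (lifts ls) ++ [])
    ≡⟨ cong₂ _+_ (trans (length-map _ (lifts ls)) (length-lifts ls))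
                 (trans (length-++ (map (halves l true ++_) (lifts ls))) (cong (_+ 0) (trans (length-map _ (lifts ls)) (length-lifts ls)))) ⟩
  2 ^ length ls + (2 ^ length ls + 0)
    ∎
  where open ≡-Reasoning

length-∈-patterns : ∀ {m t n p} → p ∈ patterns m t n → length p ≤ 6
length-∈-patterns {m} {t} {n} p∈ with ∈-++⁻ (ordering m) p∈
... | inj₁ p∈m = ≤-trans (length-∈-ordering m p∈m) (m≤m+n 3 3)
... | inj₂ p∈ʳ with ∈-++⁻ (concatMap lifts (ordering t)) p∈ʳ
...   | inj₁ p∈t = let q , q∈ , p∈q = find (∈-concatMap⁻ lifts {xs = ordering t} p∈t) in
          ≤-trans (≤-reflexive (length-∈-lifts q p∈q)) (*-monoʳ-≤ 2 (length-∈-ordering t q∈))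
...   | inj₂ p∈n with ∈-map⁻ (λ i → [ pos (code (pad i)) ]) p∈n
...     | i , _ , refl = s≤s z≤n

-- An axiom has at most 3 literals, hence at most 2 ^ 3 = 8 lifts.
length-patterns : ∀ m t n → length (patterns m t n) ≤ 5 * m * m * m + (8 * (5 * t * t * t) + n)
length-patterns m t n = begin
  length (patterns m t n)
    ≡⟨ trans (length-++ (ordering m)) (cong (length (ordering m) +_) (trans (length-++ (concatMap lifts (ordering t)))
         (cong (length (concatMap lifts (ordering t)) +_) (trans (length-map _ (upTo n)) (length-upTo n))))) ⟩
  length (ordering m) + (length (concatMap lifts (ordering t)) + n)
    ≤⟨ +-mono-≤ (length-ordering m) (+-monoˡ-≤ n (≤-trans
         (length-concatMap-≤ (ordering t) (λ {p} p∈ → ≤-trans (≤-reflexive (length-lifts p)) (^-monoʳ-≤ 2 (length-∈-ordering t p∈))))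
         (*-monoʳ-≤ 8 (length-ordering t)))) ⟩
  5 * m * m * m + (8 * (5 * t * t * t) + n)
    ∎
  where open ≤-Reasoning

size-formula-≤ : ∀ m t n → size (formula m t n) ≤ (5 * m * m * m + (8 * (5 * t * t * t) + n)) * 6
size-formula-≤ m t n = begin
  size (formula m t n)                              ≤⟨ size-toCNF (patterns m t n) ⟩
  total length (patterns m t n)                     ≤⟨ total-bound (patterns m t n) (λ {p} p∈ → length-∈-patterns {m} {t} {n} p∈) ⟩
  length (patterns m t n) * 6                       ≤⟨ *-monoˡ-≤ 6 (length-patterns m t n) ⟩
  (5 * m * m * m + (8 * (5 * t * t * t) + n)) * 6   ∎
  where open ≤-Reasoning

size-formula-≥ : ∀ m t n → n ≤ size (formula m t n)
size-formula-≥ m t n = begin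
  n                                  ≡⟨ trans (length-map _ (upTo n)) (length-upTo n) ⟨
  length padLiterals                 ≤⟨ unique-length (Unique.map⁺ pad-injective (Unique.upTo⁺ n)) occurs ⟩
  length (occurring (formula m t n)) ≡⟨ length-occurring (formula m t n) ⟩
  size (formula m t n)               ∎
  where
  open ≤-Reasoning
  padLiterals : List Literal
  padLiterals = map (pos ∘ code ∘ pad) (upTo n)
  pad-injective : ∀ {i j} → pos (code (pad i)) ≡ pos (code (pad j)) → i ≡ j
  pad-injective {i} {j} e with code-injective (pad i) (pad j) (cong var e)
  ... | refl = refl
  occurs : padLiterals ⊆ occurring (formula m t n)
  occurs l∈ with ∈-map⁻ (pos ∘ code ∘ pad) l∈
  ... | i , i∈ , refl =
    let C , C∈ , e = ∈-toCNF⁺ {ps = patterns m t n} (∈-++⁺ʳ (ordering m) (∈-++⁺ʳ (concatMap lifts (ordering t))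
                       (∈-map⁺ (λ i → [ pos (code (pad i)) ]) i∈))) ([] ∷ [])
    in ∈-concat⁺′ (Equivalence.to e (here refl)) (∈-map⁺ literals C∈)

formula-6-CNF : ∀ m t n → formula m t n is 6 -CNF
formula-6-CNF m t n = All.tabulate λ {C} C∈ → length-∈-patterns {m} {t} {n} (∈-toCNF⁻ (patterns m t n) C∈)

-- The two refutations

easy-refutation : ∀ {m t n} → 1 ≤ m →
  ∃[ ρ ] (Refutes ρ (formula m t n) × W ρ ≤ 2 * m + 1 × length ρ ≤ m * (1 + m * 2 + 2) + m * (2 + m * (m * 2 + 1)))
easy-refutation {m} {t} {n} 1≤m =
  let ρ , ref , W≤ , L≤ = refute in ρ , ref , W≤ , subst (λ c → length ρ ≤ m * (1 + m * 2 + 2) + m * c) cost≡ L≤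
  where
  has : ∀ {i j k p} → i < m → j < m → k < m → p ∈ orderingAxioms m i j k → Unique (map var p) →
    ∃[ A ] (A ∈ clauses (formula m t n) × literals A ⊆ p)
  has i< j< k< p∈ u = let A , A∈ , e = ∈-toCNF⁺ {ps = patterns m t n} (∈-++⁺ˡ (∈-ordering⁺ i< j< k< p∈)) u
                      in A , A∈ , λ l∈ → Equivalence.from e l∈
  open OrderingRefutation (formula m t n) (2 * m + 1) m ≤-refl 1≤m has

hard-refutation : ∀ {m t n} → 1 ≤ t → NarrowRefutation (formula m t n) (2 * (2 * t + 1) + 1)
hard-refutation {m} {t} {n} 1≤t = let ρ , ref , W≤ , _ = refute in lift-refutation ref W≤
  where
  E : CNF
  E = toCNF (ordering t)
  has : ∀ {i j k p} → i < t → j < t → k < t → p ∈ orderingAxioms t i j k → Unique (map var p) →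
    ∃[ A ] (A ∈ clauses E × literals A ⊆ p)
  has i< j< k< p∈ u = let A , A∈ , e = ∈-toCNF⁺ {ps = ordering t} (∈-ordering⁺ i< j< k< p∈) u
                      in A , A∈ , λ l∈ → Equivalence.from e l∈
  hasLift : ∀ {A} → A ∈ clauses E → ∀ γ → ∃[ B ] (B ∈ clauses (formula m t n) × literals B ⊆ liftBy γ (literals A))
  hasLift {A} A∈ γ =
    let B , B∈ , e = ∈-toCNF⁺ {ps = patterns m t n} (∈-++⁺ʳ (ordering m) (∈-++⁺ˡ (∈-concatMap⁺ lifts
                       (lose (∈-toCNF⁻ (ordering t) A∈) (liftBy∈lifts γ (literals A))))))
                       (liftBy-unique γ (literals A) (Clause.distinct A))
    in B , B∈ , λ l∈ → Equivalence.from e l∈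
  open OrderingRefutation E (2 * t + 1) t ≤-refl 1≤t has
  open Lifting E (formula m t n) (2 * t + 1) (2 * (2 * t + 1) + 1) ≤-refl hasLift

-- Choice of the parameters

-- `hardOrder h` is the least number above `2 * (3 * h) + 2`, as `length-bound` demands.
-- `hardWidth h` is the width of the lifted refutation for that many elements. `easyOrder h` is the
-- least number above `2 * hardWidth h + 2`, so clauses of width up to `hardWidth h` mention too few
-- elements to refute the easy part.
hardOrder hardWidth easyOrder : ℕ → ℕ
hardOrder h = 6 * h + 3
hardWidth h = 2 * (2 * hardOrder h + 1) + 1
easyOrder h = 2 * hardWidth h + 3

formulaFor : ℕ → CNF
formulaFor n = formula (easyOrder ⌊∛ n ⌋) (hardOrder ⌊∛ n ⌋) n

1≤hardOrder : ∀ h → 1 ≤ hardOrder h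
1≤hardOrder h = ≤-trans (s≤s z≤n) (m≤n+m 3 (6 * h))

1≤easyOrder : ∀ h → 1 ≤ easyOrder h
1≤easyOrder h = ≤-trans (s≤s z≤n) (m≤n+m 3 (2 * hardWidth h))

hardWidth-narrow : ∀ h → 2 * hardWidth h + 2 < easyOrder h
hardWidth-narrow h = +-monoʳ-< (2 * hardWidth h) (n<1+n 2)

h≤hardWidth : ∀ h → h ≤ hardWidth h
h≤hardWidth h = subst (h ≤_) (eq h) (m≤m+n h _)
  where
  eq : ∀ h → h + (23 * h + 15) ≡ 2 * (2 * (6 * h + 3) + 1) + 1
  eq = solve-∀

minimal : ∀ n → ∃[ w ] (W[ formulaFor n ⊢𝟘]≡ w × ⌊∛ n ⌋ ≤ w × w ≤ hardWidth ⌊∛ n ⌋)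
minimal n =
  let w , ((π , ref , W≡) , min) = minimal-width (hard-refutation {easyOrder h} {hardOrder h} {n} (1≤hardOrder h))
      ρ , refρ , W≤ = hard-refutation {easyOrder h} {hardOrder h} {n} (1≤hardOrder h)
  in w , ((π , ref , W≡) , min) , ≮⇒≥ (λ w<h → narrow w w<h ref (≤-reflexive W≡)) , ≤-trans (min ρ refρ) W≤
  where
  h : ℕ
  h = ⌊∛ n ⌋
  narrow : ∀ w → w < h → ∀ {π} → Refutes π (formulaFor n) → ¬ W π ≤ w
  narrow w w<h = width-bound {easyOrder h} {hardOrder h} {n} {w}
    (≤-<-trans (+-monoˡ-≤ 2 (*-mono-≤ (m≤m+n 2 4) (<⇒≤ w<h))) (+-monoʳ-< (6 * h) (n<1+n 2)))
    (≤-<-trans (+-monoˡ-≤ 2 (*-monoʳ-≤ 2 (≤-trans (<⇒≤ w<h) (h≤hardWidth h)))) (hardWidth-narrow h))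

long : ∀ n {π} → Refutes π (formulaFor n) → W π ≤ hardWidth ⌊∛ n ⌋ → 2 ^ ⌊∛ n ⌋ ≤ L π
long n = length-bound {easyOrder h} {hardOrder h} {n} {hardWidth h} {h} (hardWidth-narrow h) (+-mono-≤-< (≤-reflexive (sym (*-assoc 2 3 h))) (n<1+n 2))
  where
  h : ℕ
  h = ⌊∛ n ⌋

short : ∀ n → ∃[ ρ ] (Refutes ρ (formulaFor n) × W ρ ≤ 2 * easyOrder ⌊∛ n ⌋ + 1 ×
  length ρ ≤ easyOrder ⌊∛ n ⌋ * (1 + easyOrder ⌊∛ n ⌋ * 2 + 2) + easyOrder ⌊∛ n ⌋ * (2 + easyOrder ⌊∛ n ⌋ * (easyOrder ⌊∛ n ⌋ * 2 + 1)))
short n = easy-refutation {easyOrder ⌊∛ n ⌋} {hardOrder ⌊∛ n ⌋} {n} (1≤easyOrder ⌊∛ n ⌋)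

-- Asymptotics

1≤⌊∛n⌋ : ∀ {n} → 1 ≤ n → 1 ≤ ⌊∛ n ⌋
1≤⌊∛n⌋ {n} 1≤n = ≮⇒≥ λ h<1 →
  <-irrefl refl (≤-trans 1≤n (≤-pred (≤-trans (proj₂ (⌊∛⌋-spec n)) (^-monoˡ-≤ 3 h<1))))

⌊∛⌋-cube : ∀ n → ⌊∛ n ⌋ * ⌊∛ n ⌋ * ⌊∛ n ⌋ ≤ n
⌊∛⌋-cube n = ≤-trans (≤-reflexive (eq ⌊∛ n ⌋)) (proj₁ (⌊∛⌋-spec n))
  where
  eq : ∀ h → h * h * h ≡ h * (h * (h * 1))
  eq = solve-∀

affine-≤ : ∀ a b {h} → 1 ≤ h → a * h + b ≤ (a + b) * h
affine-≤ a b {h} 1≤h = begin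
  a * h + b      ≡⟨ cong (a * h +_) (*-identityʳ b) ⟨
  a * h + b * 1  ≤⟨ +-monoʳ-≤ (a * h) (*-monoʳ-≤ b 1≤h) ⟩
  a * h + b * h  ≡⟨ *-distribʳ-+ h a b ⟨
  (a + b) * h    ∎
  where open ≤-Reasoning

-- The constant 81 = 48 + 33 comes from `easyOrder`; sharing it lets `size-arithmetic` work with a
-- single factor a.
hardOrder-≤ : ∀ {h} → 1 ≤ h → hardOrder h ≤ 81 * h
hardOrder-≤ {h} 1≤h = ≤-trans (affine-≤ 6 3 1≤h) (*-monoˡ-≤ h (m≤m+n 9 72))

hardWidth-≤ : ∀ {h} → 1 ≤ h → hardWidth h ≤ 39 * h
hardWidth-≤ {h} 1≤h = ≤-trans (≤-reflexive (eq h)) (affine-≤ 24 15 1≤h)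
  where
  eq : ∀ h → 2 * (2 * (6 * h + 3) + 1) + 1 ≡ 24 * h + 15
  eq = solve-∀

easyOrder-≤ : ∀ {h} → 1 ≤ h → easyOrder h ≤ 81 * h
easyOrder-≤ {h} 1≤h = ≤-trans (≤-reflexive (eq h)) (affine-≤ 48 33 1≤h)
  where
  eq : ∀ h → 2 * (2 * (2 * (6 * h + 3) + 1) + 1) + 3 ≡ 48 * h + 33
  eq = solve-∀

cube-mono : ∀ {m M} → m ≤ M → m * m * m ≤ M * M * M
cube-mono m≤M = *-mono-≤ (*-mono-≤ m≤M m≤M) m≤M

scaled-cube : ∀ a h {n} → h * h * h ≤ n → a * h * (a * h) * (a * h) ≤ a * a * a * n
scaled-cube a h {n} h³≤n = ≤-trans (≤-reflexive (eq a h)) (*-monoʳ-≤ (a * a * a) h³≤n)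
  where
  eq : ∀ a h → a * h * (a * h) * (a * h) ≡ a * a * a * (h * h * h)
  eq = solve-∀

size-arithmetic : ∀ a {h n m t} → m ≤ a * h → t ≤ a * h → h * h * h ≤ n →
  (5 * m * m * m + (8 * (5 * t * t * t) + n)) * 6 ≤ (270 * (a * a * a) + 6) * n
size-arithmetic a {h} {n} {m} {t} m≤ t≤ h³≤n = begin
  (5 * m * m * m + (8 * (5 * t * t * t) + n)) * 6        ≡⟨ gather m t n ⟩
  30 * (m * m * m) + 240 * (t * t * t) + 6 * n           ≤⟨ +-monoˡ-≤ (6 * n) (+-mono-≤ (*-monoʳ-≤ 30 (cube m≤)) (*-monoʳ-≤ 240 (cube t≤))) ⟩
  30 * (a * a * a * n) + 240 * (a * a * a * n) + 6 * n   ≡⟨ factor a n ⟩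
  (270 * (a * a * a) + 6) * n                            ∎
  where
  open ≤-Reasoning
  cube : ∀ {k} → k ≤ a * h → k * k * k ≤ a * a * a * n
  cube k≤ = ≤-trans (cube-mono k≤) (scaled-cube a h h³≤n)
  gather : ∀ m t n → (5 * m * m * m + (8 * (5 * t * t * t) + n)) * 6 ≡ 30 * (m * m * m) + 240 * (t * t * t) + 6 * n
  gather = solve-∀
  factor : ∀ a n → 30 * (a * a * a * n) + 240 * (a * a * a * n) + 6 * n ≡ (270 * (a * a * a) + 6) * n
  factor = solve-∀

length-arithmetic : ∀ a {h n m} → 1 ≤ m → m ≤ a * h → h * h * h ≤ n →
  m * (1 + m * 2 + 2) + m * (2 + m * (m * 2 + 1)) ≤ 10 * (a * a * a) * n
length-arithmetic a {h} {n} {m@(suc _)} 1≤m m≤ h³≤n = begin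
  m * (1 + m * 2 + 2) + m * (2 + m * (m * 2 + 1))       ≡⟨ gather m ⟩
  2 * (m * m * m) + 3 * (m * m) + 5 * m                 ≤⟨ +-mono-≤ (+-monoʳ-≤ (2 * (m * m * m)) (*-monoʳ-≤ 3 (m≤m*n (m * m) m)))
                                                             (*-monoʳ-≤ 5 (≤-trans (m≤m*n m m) (m≤m*n (m * m) m))) ⟩
  2 * (m * m * m) + 3 * (m * m * m) + 5 * (m * m * m)   ≡⟨ add (m * m * m) ⟩
  10 * (m * m * m)                                      ≤⟨ *-monoʳ-≤ 10 (≤-trans (cube-mono m≤) (scaled-cube a h h³≤n)) ⟩
  10 * (a * a * a * n)                                  ≡⟨ *-assoc 10 (a * a * a) n ⟨
  10 * (a * a * a) * n                                  ∎
  where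
  open ≤-Reasoning
  gather : ∀ m → m * (1 + m * 2 + 2) + m * (2 + m * (m * 2 + 1)) ≡ 2 * (m * m * m) + 3 * (m * m) + 5 * m
  gather = solve-∀
  add : ∀ q → 2 * q + 3 * q + 5 * q ≡ 10 * q
  add = solve-∀

-- Assembling the asymptotic statements

minWidth : ℕ → ℕ
minWidth n = proj₁ (minimal n)

shortRefutation : ℕ → List Clause
shortRefutation n = proj₁ (short n)

abstract
  size-≤ : ∃[ c ] (∀ n → 1 ≤ n → size (formulaFor n) ≤ c * n)
  size-≤ = 270 * (81 * 81 * 81) + 6 , λ n 1≤n → ≤-trans (size-formula-≤ (easyOrder ⌊∛ n ⌋) (hardOrder ⌊∛ n ⌋) n)
    (size-arithmetic 81 {⌊∛ n ⌋} (easyOrder-≤ (1≤⌊∛n⌋ 1≤n)) (hardOrder-≤ (1≤⌊∛n⌋ 1≤n)) (⌊∛⌋-cube n))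

  L-≤ : ∃[ c ] (∀ n → 1 ≤ n → L (shortRefutation n) ≤ c * n)
  L-≤ = 10 * (81 * 81 * 81) , λ n 1≤n → ≤-trans (proj₂ (proj₂ (proj₂ (short n))))
    (length-arithmetic 81 {⌊∛ n ⌋} (1≤easyOrder ⌊∛ n ⌋) (easyOrder-≤ (1≤⌊∛n⌋ 1≤n)) (⌊∛⌋-cube n))

  w-≤ : ∃[ c ] (∀ n → 1 ≤ n → minWidth n ≤ c * ⌊∛ n ⌋)
  w-≤ = 39 , λ n 1≤n → ≤-trans (proj₂ (proj₂ (proj₂ (minimal n)))) (hardWidth-≤ (1≤⌊∛n⌋ 1≤n))

  W-≤ : ∃[ c ] (∀ n → 1 ≤ n → W (shortRefutation n) ≤ c * minWidth n)
  -- The constant is 2 * 81 + 1; the lower bound on the minimal width then replaces the cube root by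
  -- `minWidth n`.
  W-≤ = 163 , λ n 1≤n → ≤-trans (proj₁ (proj₂ (proj₂ (short n)))) (≤-trans (bound (1≤⌊∛n⌋ 1≤n)) (*-monoʳ-≤ 163 (proj₁ (proj₂ (proj₂ (minimal n))))))
    where
    eq : ∀ h → 2 * (81 * h) + 1 ≡ 162 * h + 1
    eq = solve-∀
    bound : ∀ {h} → 1 ≤ h → 2 * easyOrder h + 1 ≤ 163 * h
    bound {h} 1≤h = ≤-trans (+-monoˡ-≤ 1 (*-monoʳ-≤ 2 (easyOrder-≤ 1≤h))) (≤-trans (≤-reflexive (eq h)) (affine-≤ 162 1 1≤h))

at-least-1 : ∀ {f g : ℕ → ℕ} → ∃[ c ] (∀ n → 1 ≤ n → f n ≤ c * g n) → f ∈O g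
at-least-1 (c , f≤) = c , 1 , f≤

theorem5p2 : ∃[ k ] Σ[ F ∈ (ℕ → CNF) ] Σ[ w ∈ (ℕ → ℕ) ]
    (∀ n → 1 ≤ n → (F n is k -CNF) × Unsatisfiable (F n)) ×
    ((size ∘ F) ∈Θ id) ×
    ((∀ n → 1 ≤ n → W[ F n ⊢𝟘]≡ w n) × (w ∈Θ ⌊∛_⌋)) ×
    (Σ[ h ∈ (ℕ → ℕ) ] (h ∈Ω ⌊∛_⌋) ×
    (∀ n → 1 ≤ n → ∀ π → Refutes π (F n) → W π ≡ w n → 2 ^ h n ≤ L π)) ×
    (Σ[ π′ ∈ (ℕ → List Clause) ]
    (∀ n → 1 ≤ n → Refutes (π′ n) (F n)) ×
    ((W ∘ π′) ∈O w) × ((L ∘ π′) ∈O id))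
theorem5p2 = 6 , formulaFor , minWidth ,
  (λ n _ → formula-6-CNF (easyOrder ⌊∛ n ⌋) (hardOrder ⌊∛ n ⌋) n , refutable⇒unsatisfiable (proj₁ (proj₂ (short n)))) ,
  (at-least-1 size-≤ , 1 , 0 , λ n _ → ≤-trans (size-formula-≥ (easyOrder ⌊∛ n ⌋) (hardOrder ⌊∛ n ⌋) n) (≤-reflexive (sym (*-identityˡ _)))) ,
  ((λ n _ → proj₁ (proj₂ (minimal n))) ,
   at-least-1 w-≤ , 1 , 0 , λ n _ → ≤-trans (proj₁ (proj₂ (proj₂ (minimal n)))) (≤-reflexive (sym (*-identityˡ _)))) ,
  (⌊∛_⌋ , (1 , 0 , λ n _ → ≤-reflexive (sym (*-identityˡ _))) ,
   -- A refutation of minimal width is no wider than the lifted one of the hard part, so `long`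
   -- applies to it.
   λ n _ π ref W≡w → long n ref (≤-trans (≤-reflexive W≡w) (proj₂ (proj₂ (proj₂ (minimal n)))))) ,
  shortRefutation , (λ n _ → proj₁ (proj₂ (short n))) , at-least-1 W-≤ , at-least-1 L-≤
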